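{- For all $\zeta,\epsilon>0$ there is $\eta>0$ such that the following holds for all $p,\rho\in[\zeta,1-\zeta]$. If $f\colon(\{0,1\}^n,\mu_{\rho p})\to\{0,1\}$, $g\colon(\{0,1\}^n,\mu_p)\to\{0,1\}$ and $h\colon(\{0,1\}^n,\mu_\rho)\to\{0,1\}$ satisfy \[ \Pr_{\mathbf{x}\sim\mu_p,\ \mathbf{y}\sim\mu_\rho}\big[f(\mathbf{x}\wedge\mathbf{y})=g(\mathbf{x})\wedge h(\mathbf{y})\big]\ge1-\eta, \] with $\mathbf{x},\mathbf{y}$ independent, then one of the following holds: (1) $f$ and at least one of the functions $g$ or $h$ are $\epsilon$-close to the constant $0$ function; (2) there is a set $T\subseteq[n]$ such that $f,g,h$ are all $\epsilon$-close to $\mathsf{AND}_T$ (each with respect to its own input distribution).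
   Context: $\mu_q$ is the $q$-biased product measure on $\{0,1\}^n$; $x\wedge y$ is coordinatewise AND; $\mathsf{AND}_T(x)=\bigwedge_{i\in T}x_i$. A Boolean function on $(\{0,1\}^n,\mu_q)$ is $\epsilon$-close to another if they differ with probability at most $\epsilon$ under $\mu_q$.
   Formalization: The parameters ζ, ε, p and ρ (and the resulting η) range over rational numbers instead of real numbers. -}

module Defs where

open import Data.Bool using (Bool; true; false; _∧_; _∨_; not; if_then_else_)
open import Data.Nat using (ℕ; zero; suc)
open import Data.List using (List; []; _∷_; map; concatMap; foldr)
open import Data.Vec using (Vec; []; _∷_; zipWith)
open import Data.Rational using (ℚ; 0ℚ; 1ℚ; _+_; _*_; _-_; _≤_)
open import Data.Fin.Subset using (Subset)

Cube : ℕ → Set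
Cube n = Vec Bool n

cube : (n : ℕ) → List (Cube n)
cube zero    = [] ∷ []
cube (suc n) = concatMap (λ x → (false ∷ x) ∷ (true ∷ x) ∷ []) (cube n)

BoolFun : ℕ → Set
BoolFun n = Cube n → Bool

μ : ∀ {n} → ℚ → Cube n → ℚ
μ q []          = 1ℚ
μ q (true ∷ x)  = q * μ q x
μ q (false ∷ x) = (1ℚ - q) * μ q x

sumℚ : List ℚ → ℚ
sumℚ = foldr _+_ 0ℚ

𝟙 : Bool → ℚ
𝟙 true  = 1ℚ
𝟙 false = 0ℚ

Pr : ∀ {n} → ℚ → (Cube n → Bool) → ℚ
Pr {n} q P = sumℚ (map (λ x → μ q x * 𝟙 (P x)) (cube n))

_==ᵇ_ : Bool → Bool → Bool
true  ==ᵇ b = b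
false ==ᵇ b = not b

_⋀_ : ∀ {n} → Cube n → Cube n → Cube n
x ⋀ y = zipWith _∧_ x y

agreement : ∀ {n} → (p ρ : ℚ) → BoolFun n → BoolFun n → BoolFun n → ℚ
agreement {n} p ρ f g h =
  sumℚ (map (λ x → sumℚ (map (λ y → μ p x * μ ρ y * 𝟙 (f (x ⋀ y) ==ᵇ (g x ∧ h y))) (cube n))) (cube n))

Close : ∀ {n} → (q ε : ℚ) → BoolFun n → BoolFun n → Set
Close q ε f f' = Pr q (λ x → not (f x ==ᵇ f' x)) ≤ ε

zeroFun : ∀ {n} → BoolFun n
zeroFun _ = false

AND : ∀ {n} → Subset n → BoolFun n
AND T x = Data.Vec.foldr _ _∧_ true (zipWith (λ t b → not t ∨ b) T x)
  where import Data.Vec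

-- Let A = {g = 1}. For x in A, h(y) is mostly f(x ∧ y), a function of y restricted to x, so all
-- Efron–Stein components of h indexed by sets U ⊈ x are small. Averaging over x in A, the component
-- of h at U is small unless x ⊇ U for almost all x in A, that is, unless U ⊆ T, where T is the set of
-- coordinates that are almost always 1 on A. A union bound gives A ⊆ AND_T up to a small error, and
-- |T| is bounded because μ(A) ≲ p^|T|. With g and h exchanged one gets a set T' for which h implies
-- AND_T' and g is nearly a T'-junta. A function which is nearly a T-junta cannot be almost always 1
-- at a coordinate outside T, so T = T'; a T-junta that implies AND_T is 0 or AND_T.

module Submission where

open import Data.Bool as Bool using (Bool; true; false; _∧_; not)
open import Data.Bool.Properties using (∧-comm)
open import Data.Empty using (⊥-elim)
open import Data.Fin using (Fin; zero; suc)
open import Data.Fin.Subset using (Subset; ⁅_⁆; ⊥; ∣_∣)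
open import Data.Fin.Subset.Properties using (x∈⁅x⁆; ∣⊥∣≡0)
import Data.Integer as ℤ
import Data.Integer.Properties as ℤₚ
open import Data.List using (List; []; _∷_; map; concatMap)
open import Data.Nat as ℕ using (ℕ; zero; suc)
import Data.Nat.Properties as ℕₚ
open import Data.Product using (∃-syntax; _×_; _,_)
open import Data.Rational hiding (∣_∣)
open import Data.Rational.Properties
open import Data.Rational.Solver using (module +-*-Solver)
open import Data.Rational.Unnormalised as ℚᵘ using (mkℚᵘ; *≡*; *≤*)
import Data.Rational.Unnormalised.Properties as ℚᵘₚ
open import Data.Sum using (_⊎_; inj₁; inj₂)
open import Data.Unit using (tt)
open import Data.Vec using ([]; _∷_; lookup; tabulate; tail)
open import Data.Vec.Properties using (lookup∘tabulate; tabulate∘lookup; tabulate-cong; lookup-replicate; []=⇒lookup)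
open import Relation.Binary.PropositionalEquality
open import Defs
open +-*-Solver using (solve; _:=_; _:+_; _:*_; _:-_; con)

-- Order arithmetic on the rationals.

0≤* : ∀ {a b} → 0ℚ ≤ a → 0ℚ ≤ b → 0ℚ ≤ a * b
0≤* {a} {b} 0≤a 0≤b = nonNegative⁻¹ (a * b) {{nonNeg*nonNeg⇒nonNeg a {{nonNegative 0≤a}} b {{nonNegative 0≤b}}}}

0≤+ : ∀ {a b} → 0ℚ ≤ a → 0ℚ ≤ b → 0ℚ ≤ a + b
0≤+ = +-mono-≤

0<* : ∀ {a b} → 0ℚ < a → 0ℚ < b → 0ℚ < a * b
0<* {a} {b} 0<a 0<b = positive⁻¹ (a * b) {{pos*pos⇒pos a {{positive 0<a}} b {{positive 0<b}}}}

0≤- : ∀ {a b} → a ≤ b → 0ℚ ≤ b - a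
0≤- {a} {b} a≤b = subst (_≤ b - a) (+-inverseʳ a) (+-monoˡ-≤ (- a) a≤b)

-- The device for the polynomial inequalities below: the difference is written as a visibly
-- nonnegative `d`, and the identity is left to the ring solver.
≤-by : ∀ {a b d} → 0ℚ ≤ d → b ≡ a + d → a ≤ b
≤-by {a} 0≤d b≡a+d = subst₂ _≤_ (+-identityʳ a) (sym b≡a+d) (+-monoʳ-≤ a 0≤d)

*-monoʳ-≤ : ∀ {c a b} → 0ℚ ≤ c → a ≤ b → c * a ≤ c * b
*-monoʳ-≤ {c} 0≤c = *-monoˡ-≤-nonNeg c {{nonNegative 0≤c}}

*-mono-≤ : ∀ {a b c d} → 0ℚ ≤ a → 0ℚ ≤ c → a ≤ b → c ≤ d → a * c ≤ b * d
*-mono-≤ {a} {b} {c} {d} 0≤a 0≤c a≤b c≤d =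
  ≤-by (0≤+ (0≤* 0≤a (0≤- c≤d)) (0≤* (0≤- a≤b) (≤-trans 0≤c c≤d)))
    (solve 4 (λ a b c d → b :* d := a :* c :+ (a :* (d :- c) :+ (b :- a) :* d)) refl a b c d)

0≤² : ∀ a → 0ℚ ≤ a * a
0≤² a with ≤-total 0ℚ a
... | inj₁ 0≤a = 0≤* 0≤a 0≤a
... | inj₂ a≤0 = subst (0ℚ ≤_) (solve 1 (λ a → (con 0ℚ :- a) :* (con 0ℚ :- a) := a :* a) refl a)
                   (0≤* (0≤- a≤0) (0≤- a≤0))

0≤𝟙 : ∀ b → 0ℚ ≤ 𝟙 b
0≤𝟙 true  = ≤ᵇ⇒≤ tt
0≤𝟙 false = ≤ᵇ⇒≤ tt

0≤1 : 0ℚ ≤ 1ℚ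
0≤1 = ≤ᵇ⇒≤ tt

-- Weighted sums over the cube.

-- Arbitrary weights let the biased expectation `E` and the plain sum `S` over sets share linearity,
-- monotonicity and Fubini.
∑ : ∀ {n} → ℚ → ℚ → (Cube n → ℚ) → ℚ
∑ {zero}  a b φ = φ []
∑ {suc n} a b φ = a * ∑ a b (λ x → φ (false ∷ x)) + b * ∑ a b (λ x → φ (true ∷ x))

E : ∀ {n} → ℚ → (Cube n → ℚ) → ℚ
E q = ∑ (1ℚ - q) q

S : ∀ {n} → (Cube n → ℚ) → ℚ
S = ∑ 1ℚ 1ℚ

∑-cong : ∀ {n} {a b} {φ ψ : Cube n → ℚ} → (∀ x → φ x ≡ ψ x) → ∑ a b φ ≡ ∑ a b ψ
∑-cong {zero}  eq = eq []
∑-cong {suc n} {a} {b} eq = cong₂ (λ u v → a * u + b * v) (∑-cong (λ x → eq (false ∷ x))) (∑-cong (λ x → eq (true ∷ x)))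

∑-linear : ∀ {n} {a b} s t (φ ψ : Cube n → ℚ) → ∑ a b (λ x → s * φ x + t * ψ x) ≡ s * ∑ a b φ + t * ∑ a b ψ
∑-linear {zero}  s t φ ψ = refl
∑-linear {suc n} {a} {b} s t φ ψ = trans
  (cong₂ (λ u v → a * u + b * v) (∑-linear s t (λ x → φ (false ∷ x)) (λ x → ψ (false ∷ x)))
                                 (∑-linear s t (λ x → φ (true ∷ x)) (λ x → ψ (true ∷ x))))
  (solve 8 (λ a b s t u v w z → a :* (s :* u :+ t :* v) :+ b :* (s :* w :+ t :* z)
     := s :* (a :* u :+ b :* w) :+ t :* (a :* v :+ b :* z)) refl a b s t _ _ _ _)

∑-+ : ∀ {n} {a b} (φ ψ : Cube n → ℚ) → ∑ a b (λ x → φ x + ψ x) ≡ ∑ a b φ + ∑ a b ψ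
∑-+ {n} {a} {b} φ ψ = trans (∑-cong (λ x → sym (cong₂ _+_ (*-identityˡ (φ x)) (*-identityˡ (ψ x)))))
  (trans (∑-linear 1ℚ 1ℚ φ ψ) (cong₂ _+_ (*-identityˡ (∑ a b φ)) (*-identityˡ (∑ a b ψ))))

∑-*ˡ : ∀ {n} {a b} c (φ : Cube n → ℚ) → ∑ a b (λ x → c * φ x) ≡ c * ∑ a b φ
∑-*ˡ {zero}  c φ = refl
∑-*ˡ {suc n} {a} {b} c φ = trans
  (cong₂ (λ u v → a * u + b * v) (∑-*ˡ c (λ x → φ (false ∷ x))) (∑-*ˡ c (λ x → φ (true ∷ x))))
  (solve 5 (λ a b c u v → a :* (c :* u) :+ b :* (c :* v) := c :* (a :* u :+ b :* v)) refl a b c _ _)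

∑-sub : ∀ {n} {a b} (φ ψ : Cube n → ℚ) → ∑ a b (λ x → φ x - ψ x) ≡ ∑ a b φ - ∑ a b ψ
∑-sub {n} {a} {b} φ ψ = trans
  (∑-cong (λ x → solve 2 (λ u v → u :- v := con 1ℚ :* u :+ con (- 1ℚ) :* v) refl (φ x) (ψ x)))
  (trans (∑-linear 1ℚ (- 1ℚ) φ ψ)
    (solve 2 (λ u v → con 1ℚ :* u :+ con (- 1ℚ) :* v := u :- v) refl (∑ a b φ) (∑ a b ψ)))

∑-swap : ∀ {m n} {a b c d} (φ : Cube m → Cube n → ℚ) →
  ∑ a b (λ x → ∑ c d (φ x)) ≡ ∑ c d (λ y → ∑ a b (λ x → φ x y))
∑-swap {zero}  φ = refl
∑-swap {suc m} {n} {a} {b} φ = trans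
  (cong₂ (λ u v → a * u + b * v) (∑-swap (λ x → φ (false ∷ x))) (∑-swap (λ x → φ (true ∷ x))))
  (sym (∑-linear {n} a b _ _))

∑-mono : ∀ {n} {a b} → 0ℚ ≤ a → 0ℚ ≤ b → {φ ψ : Cube n → ℚ} → (∀ x → φ x ≤ ψ x) → ∑ a b φ ≤ ∑ a b ψ
∑-mono {zero}  0≤a 0≤b le = le []
∑-mono {suc n} 0≤a 0≤b le = +-mono-≤ (*-monoʳ-≤ 0≤a (∑-mono 0≤a 0≤b (λ x → le (false ∷ x))))
                                     (*-monoʳ-≤ 0≤b (∑-mono 0≤a 0≤b (λ x → le (true ∷ x))))

∑-zero : ∀ n {a b} → ∑ {n} a b (λ _ → 0ℚ) ≡ 0ℚ
∑-zero n {a} {b} = trans (∑-*ˡ {n} 0ℚ (λ _ → 0ℚ)) (*-zeroˡ (∑ {n} a b (λ _ → 0ℚ)))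

∑-nonneg : ∀ {n} {a b} → 0ℚ ≤ a → 0ℚ ≤ b → {φ : Cube n → ℚ} → (∀ x → 0ℚ ≤ φ x) → 0ℚ ≤ ∑ a b φ
∑-nonneg {n} {a} {b} 0≤a 0≤b {φ} le = subst (_≤ ∑ a b φ) (∑-zero n) (∑-mono 0≤a 0≤b le)

E-const : ∀ n q c → E {n} q (λ _ → c) ≡ c
E-const zero    q c = refl
E-const (suc n) q c = trans (cong₂ (λ u v → (1ℚ - q) * u + q * v) (E-const n q c) (E-const n q c))
  (solve 2 (λ q c → (con 1ℚ :- q) :* c :+ q :* c := c) refl q c)

E-mean : ∀ {n} q t (φ ψ : Cube n → ℚ) → E q (λ x → (1ℚ - t) * φ x + t * ψ x) ≡ (1ℚ - t) * E q φ + t * E q ψ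
E-mean q t = ∑-linear (1ℚ - t) t

term≤S : ∀ {n} {φ : Cube n → ℚ} → (∀ U → 0ℚ ≤ φ U) → ∀ U → φ U ≤ S φ
term≤S 0≤φ []          = ≤-refl
term≤S {φ = φ} 0≤φ (false ∷ U) = ≤-trans (term≤S (λ V → 0≤φ (false ∷ V)) U)
  (≤-by (∑-nonneg 0≤1 0≤1 (λ V → 0≤φ (true ∷ V))) (cong₂ _+_ (*-identityˡ (S (λ V → φ (false ∷ V)))) (*-identityˡ (S (λ V → φ (true ∷ V))))))
term≤S {φ = φ} 0≤φ (true ∷ U)  = ≤-trans (term≤S (λ V → 0≤φ (true ∷ V)) U)
  (≤-by (∑-nonneg 0≤1 0≤1 (λ V → 0≤φ (false ∷ V)))
    (solve 2 (λ a b → con 1ℚ :* a :+ con 1ℚ :* b := b :+ a) refl (S (λ V → φ (false ∷ V))) (S (λ V → φ (true ∷ V)))))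

-- Efron-Stein components and Parseval.

mean : ∀ {n} → ℚ → (Cube (suc n) → ℚ) → Cube n → ℚ
mean q h x = (1ℚ - q) * h (false ∷ x) + q * h (true ∷ x)

-- With first bit `b`, `h` equals `mean q h` plus `(b - q)` times `diff h`; the centred bit has
-- variance `q * (1ℚ - q)`, which is the factor in `F`.
diff : ∀ {n} → (Cube (suc n) → ℚ) → Cube n → ℚ
diff h x = h (true ∷ x) - h (false ∷ x)

-- The squared norm under μ q of the Efron–Stein (q-biased Fourier) component of h indexed by U.
-- Tracking the squared norm rather than the coefficient avoids √(q (1 - q)), which need not be rational.
F : ∀ {n} → ℚ → Cube n → (Cube n → ℚ) → ℚ
F q []          h = h [] * h []
F q (false ∷ U) h = F q U (mean q h)
F q (true ∷ U)  h = q * (1ℚ - q) * F q U (diff h)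

F-cong : ∀ {n} {q} (U : Cube n) {h k : Cube n → ℚ} → (∀ x → h x ≡ k x) → F q U h ≡ F q U k
F-cong []          eq = cong₂ _*_ (eq []) (eq [])
F-cong {q = q} (false ∷ U) eq = F-cong U (λ x → cong₂ (λ u v → (1ℚ - q) * u + q * v) (eq (false ∷ x)) (eq (true ∷ x)))
F-cong {q = q} (true ∷ U)  eq = cong (q * (1ℚ - q) *_) (F-cong U (λ x → cong₂ _-_ (eq (true ∷ x)) (eq (false ∷ x))))

-- The component is linear in the function, so its squared norm obeys the two-point variance
-- identity: mean of squares = square of mean + `t (1 - t)` times squared difference.
F-combine : ∀ {n} {q} (U : Cube n) t (h k : Cube n → ℚ) →
  F q U (λ x → (1ℚ - t) * h x + t * k x) + t * (1ℚ - t) * F q U (λ x → k x - h x)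
    ≡ (1ℚ - t) * F q U h + t * F q U k
F-combine []  t h k = solve 3 (λ t a b →
  ((con 1ℚ :- t) :* a :+ t :* b) :* ((con 1ℚ :- t) :* a :+ t :* b) :+ t :* (con 1ℚ :- t) :* ((b :- a) :* (b :- a))
    := (con 1ℚ :- t) :* (a :* a) :+ t :* (b :* b)) refl t (h []) (k [])
F-combine {q = q} (false ∷ U) t h k = trans
  (cong₂ (λ u v → u + t * (1ℚ - t) * v)
    (F-cong U (λ x → solve 6 (λ q t a b c d →
       (con 1ℚ :- q) :* ((con 1ℚ :- t) :* a :+ t :* c) :+ q :* ((con 1ℚ :- t) :* b :+ t :* d)
       := (con 1ℚ :- t) :* ((con 1ℚ :- q) :* a :+ q :* b) :+ t :* ((con 1ℚ :- q) :* c :+ q :* d))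
       refl q t (h (false ∷ x)) (h (true ∷ x)) (k (false ∷ x)) (k (true ∷ x))))
    (F-cong U (λ x → solve 5 (λ q a b c d →
       (con 1ℚ :- q) :* (c :- a) :+ q :* (d :- b)
       := ((con 1ℚ :- q) :* c :+ q :* d) :- ((con 1ℚ :- q) :* a :+ q :* b))
       refl q (h (false ∷ x)) (h (true ∷ x)) (k (false ∷ x)) (k (true ∷ x)))))
  (F-combine U t (mean q h) (mean q k))
F-combine {q = q} (true ∷ U) t h k = trans
  (cong₂ (λ u v → q * (1ℚ - q) * u + t * (1ℚ - t) * (q * (1ℚ - q) * v))
    (F-cong U (λ x → solve 5 (λ t a b c d →
       ((con 1ℚ :- t) :* b :+ t :* d) :- ((con 1ℚ :- t) :* a :+ t :* c)
       := (con 1ℚ :- t) :* (b :- a) :+ t :* (d :- c))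
       refl t (h (false ∷ x)) (h (true ∷ x)) (k (false ∷ x)) (k (true ∷ x))))
    (F-cong U (λ x → solve 4 (λ a b c d → (d :- b) :- (c :- a) := (d :- c) :- (b :- a))
       refl (h (false ∷ x)) (h (true ∷ x)) (k (false ∷ x)) (k (true ∷ x)))))
  (trans
    (solve 4 (λ r s u v → r :* u :+ s :* (r :* v) := r :* (u :+ s :* v)) refl (q * (1ℚ - q)) (t * (1ℚ - t)) _ _)
    (trans (cong (q * (1ℚ - q) *_) (F-combine U t (diff h) (diff k)))
      (solve 4 (λ r t u v → r :* ((con 1ℚ :- t) :* u :+ t :* v) := (con 1ℚ :- t) :* (r :* u) :+ t :* (r :* v))
        refl (q * (1ℚ - q)) t (F q U (diff h)) (F q U (diff k)))))

-- Parseval in one coordinate. The weight `w` ignores that coordinate: it is `1ℚ` in `parseval` and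
-- the indicator of a subcube in `R-variance≤W`.
E-sq-split : ∀ {n} q (w : Cube n → ℚ) (h : Cube (suc n) → ℚ) →
  (1ℚ - q) * E q (λ x → w x * (h (false ∷ x) * h (false ∷ x))) + q * E q (λ x → w x * (h (true ∷ x) * h (true ∷ x)))
    ≡ E q (λ x → w x * (mean q h x * mean q h x)) + q * (1ℚ - q) * E q (λ x → w x * (diff h x * diff h x))
E-sq-split {n} q w h = trans (sym (E-mean {n} q q _ _)) (trans
  (∑-cong (λ x → solve 4 (λ q w a b → (con 1ℚ :- q) :* (w :* (a :* a)) :+ q :* (w :* (b :* b))
    := w :* (((con 1ℚ :- q) :* a :+ q :* b) :* ((con 1ℚ :- q) :* a :+ q :* b))
       :+ q :* (con 1ℚ :- q) :* (w :* ((b :- a) :* (b :- a))))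
    refl q (w x) (h (false ∷ x)) (h (true ∷ x))))
  (trans (∑-+ {n} _ _) (cong (E q (λ x → w x * (mean q h x * mean q h x)) +_) (∑-*ˡ {n} (q * (1ℚ - q)) _))))

parseval : ∀ {n} q (h : Cube n → ℚ) → E q (λ x → 1ℚ * (h x * h x)) ≡ S (λ U → F q U h)
parseval {zero}  q h = *-identityˡ _
parseval {suc n} q h = trans (E-sq-split q (λ _ → 1ℚ) h) (cong₂ _+_
  (trans (parseval q (mean q h)) (sym (*-identityˡ _)))
  (trans (cong (q * (1ℚ - q) *_) (parseval q (diff h)))
    (trans (sym (∑-*ˡ (q * (1ℚ - q)) (λ U → F q U (diff h)))) (sym (*-identityˡ _)))))

F-nonneg : ∀ {n} {q} → 0ℚ ≤ q → 0ℚ ≤ 1ℚ - q → ∀ (U : Cube n) h → 0ℚ ≤ F q U h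
F-nonneg 0≤q q≤1 []          h = 0≤² (h [])
F-nonneg 0≤q q≤1 (false ∷ U) h = F-nonneg 0≤q q≤1 U _
F-nonneg 0≤q q≤1 (true ∷ U)  h = 0≤* (0≤* 0≤q q≤1) (F-nonneg 0≤q q≤1 U _)

-- The subtracted function ignores the coordinates where `x` is 0, and `U` contains one of them.
-- Stating `h'` by a pointwise equation lets the induction pass through `mean` and `diff` without
-- function extensionality.
F-shift : ∀ {n} {q} (U x : Cube n) → AND U x ≡ false → (k : Cube n → ℚ) {h h' : Cube n → ℚ} →
  (∀ y → h' y ≡ h y - k (x ⋀ y)) → F q U h' ≡ F q U h
F-shift [] [] ()
F-shift {q = q} (false ∷ U) (s ∷ x) U⊈x k {h} eq = F-shift U x U⊈x
  (λ z → (1ℚ - q) * k ((s ∧ false) ∷ z) + q * k ((s ∧ true) ∷ z))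
  (λ y → trans (cong₂ (λ u v → (1ℚ - q) * u + q * v) (eq (false ∷ y)) (eq (true ∷ y)))
    (solve 5 (λ q a b c d → (con 1ℚ :- q) :* (a :- c) :+ q :* (b :- d)
       := ((con 1ℚ :- q) :* a :+ q :* b) :- ((con 1ℚ :- q) :* c :+ q :* d))
      refl q (h (false ∷ y)) (h (true ∷ y)) _ _))
F-shift {q = q} (true ∷ U) (true ∷ x) U⊈x k {h} eq = cong (q * (1ℚ - q) *_) (F-shift U x U⊈x (diff k)
  (λ y → trans (cong₂ _-_ (eq (true ∷ y)) (eq (false ∷ y)))
    (solve 4 (λ a b c d → (b :- d) :- (a :- c) := (b :- a) :- (d :- c))
      refl (h (false ∷ y)) (h (true ∷ y)) _ _)))
F-shift {q = q} (true ∷ U) (false ∷ x) U⊈x k {h} eq = cong (q * (1ℚ - q) *_) (F-cong U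
  (λ y → trans (cong₂ _-_ (eq (true ∷ y)) (eq (false ∷ y)))
    (solve 3 (λ a b c → (b :- c) :- (a :- c) := b :- a)
      refl (h (false ∷ y)) (h (true ∷ y)) _)))

-- AND U T says that U ⊆ T, so W is the squared distance of h from the functions of the coordinates in T.
W : ∀ {n} → ℚ → Cube n → (Cube n → ℚ) → ℚ
W q T h = S (λ U → 𝟙 (not (AND U T)) * F q U h)

𝟙*≤ : ∀ b {a} → 0ℚ ≤ a → 𝟙 b * a ≤ a
𝟙*≤ true  {a} 0≤a = ≤-reflexive (*-identityˡ a)
𝟙*≤ false {a} 0≤a = ≤-trans (≤-reflexive (*-zeroˡ a)) 0≤a

F-⊥ : ∀ {n} q (h : Cube n → ℚ) → F q ⊥ h ≡ E q h * E q h
F-⊥ {zero} q  h = refl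
F-⊥ {suc n} q h = trans (F-⊥ q (mean q h)) (cong₂ _*_ (E-mean {n} q q _ _) (E-mean {n} q q _ _))

-- Restriction to a subcube, and the weight outside `T`.

-- The integral over the subcube is left undivided by the subcube's measure, so no division occurs.
R : ∀ {n} → ℚ → Cube n → (Cube n → ℚ) → ℚ
R q T φ = E q (λ x → 𝟙 (AND T x) * φ x)

R-true : ∀ {n} q (T : Cube n) φ → R q (true ∷ T) φ ≡ q * R q T (λ x → φ (true ∷ x))
R-true {n} q T φ = trans
  (cong (λ u → (1ℚ - q) * u + q * R q T (λ x → φ (true ∷ x)))
    (trans (∑-cong (λ x → *-zeroˡ (φ (false ∷ x)))) (∑-zero n)))
  (solve 2 (λ q b → (con 1ℚ :- q) :* con 0ℚ :+ q :* b := q :* b) refl q _)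

R-false : ∀ {n} q (T : Cube n) φ → R q (false ∷ T) φ ≡ R q T (mean q φ)
R-false {n} q T φ = trans (sym (E-mean {n} q q _ _))
  (∑-cong (λ x → solve 4 (λ q w a b → (con 1ℚ :- q) :* (w :* a) :+ q :* (w :* b)
        := w :* ((con 1ℚ :- q) :* a :+ q :* b)) refl q (𝟙 (AND T x)) (φ (false ∷ x)) (φ (true ∷ x))))

-- Whether `U ⊆ T` does not depend on a coordinate lying in `T`, so the components with and without
-- it carry the same indicator and add up by `F-combine`.
W-true : ∀ {n} q (T : Cube n) (h : Cube (suc n) → ℚ) →
  W q (true ∷ T) h ≡ (1ℚ - q) * W q T (λ x → h (false ∷ x)) + q * W q T (λ x → h (true ∷ x))
W-true {n} q T h = trans
  (cong₂ _+_ (*-identityˡ (W q T (mean q h)))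
    (*-identityˡ (S (λ U → 𝟙 (not (AND U T)) * (q * (1ℚ - q) * F q U (diff h))))))
  (trans (sym (∑-+ {n} _ _)) (trans
    (∑-cong (λ U → trans
      (sym (*-distribˡ-+ (𝟙 (not (AND U T))) (F q U (mean q h)) (q * (1ℚ - q) * F q U (diff h))))
      (trans (cong (𝟙 (not (AND U T)) *_) (F-combine U q (λ x → h (false ∷ x)) (λ x → h (true ∷ x))))
        (solve 4 (λ q w a b → w :* ((con 1ℚ :- q) :* a :+ q :* b) := (con 1ℚ :- q) :* (w :* a) :+ q :* (w :* b))
          refl q (𝟙 (not (AND U T))) (F q U (λ x → h (false ∷ x))) (F q U (λ x → h (true ∷ x)))))))
    (∑-linear {n} (1ℚ - q) q _ _)))

-- Every set containing a coordinate outside `T` counts in full, and `parseval` sums these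
-- components.
W-false : ∀ {n} q (T : Cube n) (h : Cube (suc n) → ℚ) →
  W q (false ∷ T) h ≡ W q T (mean q h) + q * (1ℚ - q) * E q (λ x → diff h x * diff h x)
W-false {n} q T h = cong₂ _+_ (*-identityˡ (W q T (mean q h)))
  (trans (*-identityˡ (S (λ U → 1ℚ * (q * (1ℚ - q) * F q U (diff h)))))
    (trans (∑-cong (λ U → *-identityˡ (q * (1ℚ - q) * F q U (diff h))))
      (trans (∑-*ˡ (q * (1ℚ - q)) (λ U → F q U (diff h)))
        (cong (q * (1ℚ - q) *_) (trans (sym (parseval q (diff h)))
          (∑-cong (λ x → *-identityˡ (diff h x * diff h x))))))))

module _ {q : ℚ} (0≤q : 0ℚ ≤ q) (q≤1 : 0ℚ ≤ 1ℚ - q) where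

  E-mono : ∀ {n} {φ ψ : Cube n → ℚ} → (∀ x → φ x ≤ ψ x) → E q φ ≤ E q ψ
  E-mono = ∑-mono q≤1 0≤q

  E-nonneg : ∀ {n} {φ : Cube n → ℚ} → (∀ x → 0ℚ ≤ φ x) → 0ℚ ≤ E q φ
  E-nonneg = ∑-nonneg q≤1 0≤q

  -- A function k (x ⋀ _) has no component outside x, so subtracting it leaves those of h unchanged.
  W≤distance : ∀ {n} (x : Cube n) (h k : Cube n → ℚ) →
    W q x h ≤ E q (λ y → (h y - k (x ⋀ y)) * (h y - k (x ⋀ y)))
  W≤distance x h k = ≤-trans (∑-mono 0≤1 0≤1 below)
    (≤-reflexive (trans (sym (parseval q d)) (∑-cong (λ y → *-identityˡ (d y * d y)))))
    where
    d : Cube _ → ℚ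
    d y = h y - k (x ⋀ y)
    below : ∀ U → 𝟙 (not (AND U x)) * F q U h ≤ F q U d
    below U with AND U x in U⊈x
    ... | true  = ≤-trans (≤-reflexive (*-zeroˡ (F q U h))) (F-nonneg 0≤q q≤1 U d)
    ... | false = ≤-reflexive (trans (*-identityˡ (F q U h)) (sym (F-shift U x U⊈x k (λ _ → refl))))

  -- `b` is the covariance of `h` with the event `x_j = 0`. It equals `q (1 - q)` times the
  -- difference of the two conditional means, while the component is `q (1 - q)` times the square of
  -- that difference; hence `b * b` is `q (1 - q)` times the component.
  F-singleton : ∀ {n} (j : Fin n) (h : Cube n → ℚ) →
    let b = E q (λ x → 𝟙 (not (lookup x j)) * h x) - (1ℚ - q) * E q h in b * b ≤ F q ⁅ j ⁆ h
  F-singleton {suc n} zero h = ≤-by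
    (0≤* (0≤* 0≤q q≤1) (0≤* (0≤+ q≤1 (0≤² q)) (0≤² (v - u))))
    (trans (cong (q * (1ℚ - q) *_) (trans (F-⊥ q (diff h)) (cong₂ _*_ (∑-sub h₁ h₀) (∑-sub h₁ h₀))))
      (trans (solve 3 (λ q u v → q :* (con 1ℚ :- q) :* ((v :- u) :* (v :- u)) :=
          ((con 1ℚ :- q) :* u :+ q :* con 0ℚ :- (con 1ℚ :- q) :* ((con 1ℚ :- q) :* u :+ q :* v))
          :* ((con 1ℚ :- q) :* u :+ q :* con 0ℚ :- (con 1ℚ :- q) :* ((con 1ℚ :- q) :* u :+ q :* v))
          :+ q :* (con 1ℚ :- q) :* ((con 1ℚ :- q :+ q :* q) :* ((v :- u) :* (v :- u)))) refl q u v)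
        (cong (_+ q * (1ℚ - q) * ((1ℚ - q + q * q) * ((v - u) * (v - u)))) (cong₂ _*_ e e))))
    where
    h₀ h₁ : Cube n → ℚ
    h₀ x = h (false ∷ x)
    h₁ x = h (true ∷ x)
    u v : ℚ
    u = E q h₀
    v = E q h₁
    e : (1ℚ - q) * u + q * 0ℚ - (1ℚ - q) * ((1ℚ - q) * u + q * v)
      ≡ (1ℚ - q) * E q (λ x → 1ℚ * h₀ x) + q * E q (λ x → 0ℚ * h₁ x) - (1ℚ - q) * ((1ℚ - q) * u + q * v)
    e = cong₂ (λ a b → (1ℚ - q) * a + q * b - (1ℚ - q) * ((1ℚ - q) * u + q * v))
      (∑-cong (λ x → sym (*-identityˡ (h₀ x))))
      (trans (sym (∑-zero n)) (∑-cong (λ x → sym (*-zeroˡ (h₁ x)))))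
  F-singleton {suc n} (suc j) h = subst (λ b → b * b ≤ F q ⁅ j ⁆ (mean q h))
    (cong₂ (λ a b → a - (1ℚ - q) * b)
      (trans (∑-cong (λ x → solve 4 (λ q w a b → w :* ((con 1ℚ :- q) :* a :+ q :* b)
          := (con 1ℚ :- q) :* (w :* a) :+ q :* (w :* b)) refl q (𝟙 (not (lookup x j))) (h (false ∷ x)) (h (true ∷ x))))
        (E-mean {n} q q _ _))
      (E-mean {n} q q _ _))
    (F-singleton j (mean q h))

  R-1≤1 : ∀ {n} (T : Cube n) → R q T (λ _ → 1ℚ) ≤ 1ℚ
  R-1≤1 {n} T = ≤-trans (E-mono (λ x → 𝟙*≤ (AND T x) 0≤1)) (≤-reflexive (E-const n q 1ℚ))

  W-nonneg : ∀ {n} (T : Cube n) h → 0ℚ ≤ W q T h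
  W-nonneg T h = ∑-nonneg 0≤1 0≤1 (λ U → 0≤* (0≤𝟙 (not (AND U T))) (F-nonneg 0≤q q≤1 U h))

  -- If r is the measure of {AND T = 1}, the left-hand side minus (R q T h)² is r² times the conditional
  -- variance of h on that subcube, one of the terms of the expected conditional variance W q T h.
  R-variance≤W : ∀ {n} (T : Cube n) (h : Cube n → ℚ) →
    R q T (λ _ → 1ℚ) * R q T (λ x → h x * h x) ≤ R q T h * R q T h + W q T h
  R-variance≤W [] h = ≤-reflexive (solve 1 (λ a → (con 1ℚ :* con 1ℚ) :* (con 1ℚ :* (a :* a))
    := (con 1ℚ :* a) :* (con 1ℚ :* a) :+ con 0ℚ :* (a :* a)) refl (h []))
  R-variance≤W {suc n} (true ∷ T) h = subst₂ _≤_
    (sym (cong₂ _*_ (R-true q T (λ _ → 1ℚ)) (R-true q T (λ x → h x * h x))))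
    (sym (cong₂ _+_ (cong₂ _*_ (R-true q T h) (R-true q T h)) (W-true q T h)))
    (≤-by
      -- `R` sees only the half `h₁`, scaled by `q`, so the induction hypothesis enters with factor
      -- `q * q`. `W` scales by `q` only; the surplus is nonnegative.
      (0≤+ (0≤* (0≤² q) (0≤- (R-variance≤W T h₁)))
        (0≤+ (0≤* q≤1 (W-nonneg T h₀)) (0≤* (0≤* 0≤q q≤1) (W-nonneg T h₁))))
      (solve 6 (λ q a b c w₀ w₁ → (q :* c) :* (q :* c) :+ ((con 1ℚ :- q) :* w₀ :+ q :* w₁)
        := (q :* a) :* (q :* b) :+ (q :* q :* ((c :* c :+ w₁) :- a :* b)
           :+ ((con 1ℚ :- q) :* w₀ :+ q :* (con 1ℚ :- q) :* w₁)))
        refl q (R q T (λ _ → 1ℚ)) (R q T (λ x → h₁ x * h₁ x)) (R q T h₁) (W q T h₀) (W q T h₁)))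
    where
    h₀ h₁ : Cube n → ℚ
    h₀ x = h (false ∷ x)
    h₁ x = h (true ∷ x)
  R-variance≤W {suc n} (false ∷ T) h = subst₂ _≤_
    (sym (cong₂ _*_ one (E-sq-split q (λ x → 𝟙 (AND T x)) h)))
    (sym (cong₂ _+_ (cong₂ _*_ (R-false q T h) (R-false q T h)) (W-false q T h)))
    (≤-by
      -- The first bit adds a `diff` term to both sides: on the left over the subcube and multiplied
      -- by its measure, on the right over the whole cube.
      (0≤+ (0≤- (R-variance≤W T (mean q h)))
        (0≤* (0≤* 0≤q q≤1) (0≤- (≤-trans (*-mono-≤ (E-nonneg (λ x → 0≤* (0≤𝟙 (AND T x)) 0≤1)) Rd≥0 (R-1≤1 T) Rd≤Ed)
          (≤-reflexive (*-identityˡ Ed))))))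
      (solve 7 (λ v a b d c w e → c :* c :+ (w :+ v :* e)
        := a :* (b :+ v :* d) :+ (((c :* c :+ w) :- a :* b) :+ v :* (e :- a :* d)))
        refl (q * (1ℚ - q)) (R q T (λ _ → 1ℚ)) (R q T (λ x → mean q h x * mean q h x))
          (R q T (λ x → diff h x * diff h x)) (R q T (mean q h)) (W q T (mean q h)) Ed))
    where
    Ed : ℚ
    Ed = E q (λ x → diff h x * diff h x)
    Rd≥0 : 0ℚ ≤ R q T (λ x → diff h x * diff h x)
    Rd≥0 = E-nonneg (λ x → 0≤* (0≤𝟙 (AND T x)) (0≤² (diff h x)))
    Rd≤Ed : R q T (λ x → diff h x * diff h x) ≤ Ed
    Rd≤Ed = E-mono (λ x → 𝟙*≤ (AND T x) (0≤² (diff h x)))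
    one : R q (false ∷ T) (λ _ → 1ℚ) ≡ R q T (λ _ → 1ℚ)
    one = solve 2 (λ q a → (con 1ℚ :- q) :* a :+ q :* a := a) refl q (R q T (λ _ → 1ℚ))

-- Indicators and `AND`.

𝟙-+ : ∀ b a → a ≡ 𝟙 b * a + 𝟙 (not b) * a
𝟙-+ true  a = solve 1 (λ a → a := con 1ℚ :* a :+ con 0ℚ :* a) refl a
𝟙-+ false a = solve 1 (λ a → a := con 0ℚ :* a :+ con 1ℚ :* a) refl a

𝟙-antitone : ∀ a b → (b ≡ true → a ≡ true) → 𝟙 (not a) ≤ 𝟙 (not b)
𝟙-antitone true  b     _   = 0≤𝟙 (not b)
𝟙-antitone false false _   = ≤-refl
𝟙-antitone false true  b⇒a with () ← b⇒a refl

AND-lookup : ∀ {n} (T x : Cube n) j → lookup T j ≡ true → AND T x ≡ true → lookup x j ≡ true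
AND-lookup (true ∷ T)  (true ∷ x) zero    _  _  = refl
AND-lookup (false ∷ T) (b ∷ x)    (suc j) Tj Tx = AND-lookup T x j Tj Tx
AND-lookup (true ∷ T)  (true ∷ x) (suc j) Tj Tx = AND-lookup T x j Tj Tx

AND-witness : ∀ {n} (T x : Cube n) → AND T x ≡ false → ∃[ j ] (lookup T j ≡ true × lookup x j ≡ false)
AND-witness []          []          ()
AND-witness (true ∷ T)  (false ∷ x) _ = zero , refl , refl
AND-witness (true ∷ T)  (true ∷ x)  T⊈x with AND-witness T x T⊈x
... | j , Tj , xj = suc j , Tj , xj
AND-witness (false ∷ T) (b ∷ x)     T⊈x with AND-witness T x T⊈x
... | j , Tj , xj = suc j , Tj , xj

AND-⋀ : ∀ {n} (T x y : Cube n) → AND T (x ⋀ y) ≡ AND T x ∧ AND T y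
AND-⋀ []          []          []          = refl
AND-⋀ (false ∷ T) (a ∷ x)     (b ∷ y)     = AND-⋀ T x y
AND-⋀ (true ∷ T)  (true ∷ x)  (true ∷ y)  = AND-⋀ T x y
AND-⋀ (true ∷ T)  (false ∷ x) (b ∷ y)     = refl
AND-⋀ (true ∷ T)  (true ∷ x)  (false ∷ y) with AND T x
... | true  = refl
... | false = refl

-- Frequent coordinates and the averaging argument.

-- The threshold is on the joint probability of `g = 1` and `x_j = 0`, not on a conditional one,
-- which avoids dividing by the measure of `g`.
frequent : ∀ {n} → ℚ → ℚ → BoolFun n → Subset n
frequent q κ g = tabulate (λ j → E q (λ x → 𝟙 (not (lookup x j)) * 𝟙 (g x)) ≤ᵇ κ)

frequent-true : ∀ {n} q κ (g : BoolFun n) j → lookup (frequent q κ g) j ≡ true →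
  E q (λ x → 𝟙 (not (lookup x j)) * 𝟙 (g x)) ≤ κ
frequent-true q κ g j eq = ≤ᵇ⇒≤ (subst Bool.T (sym (trans (sym (lookup∘tabulate _ j)) eq)) tt)

frequent-false : ∀ {n} q κ (g : BoolFun n) j → lookup (frequent q κ g) j ≡ false →
  κ ≤ E q (λ x → 𝟙 (not (lookup x j)) * 𝟙 (g x))
frequent-false q κ g j eq with ≤-total κ (E q (λ x → 𝟙 (not (lookup x j)) * 𝟙 (g x)))
... | inj₁ κ≤e = κ≤e
... | inj₂ e≤κ = ⊥-elim (subst Bool.T (trans (sym (lookup∘tabulate _ j)) eq) (≤⇒≤ᵇ e≤κ))

-- A set `U` not inside the frequent set has an infrequent `j`. Points with `g x = 1` and `x_j = 0`
-- have measure at least `κ`, and none of them contains `U`, so its component is counted in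
-- `W ρ x h` for all of them. Summing over `U` and exchanging sums finishes.
κW≤average : ∀ {n} {p ρ κ} → 0ℚ ≤ p → 0ℚ ≤ 1ℚ - p → 0ℚ ≤ ρ → 0ℚ ≤ 1ℚ - ρ → (g : BoolFun n) (h : Cube n → ℚ) →
  κ * W ρ (frequent p κ g) h ≤ E p (λ x → 𝟙 (g x) * W ρ x h)
κW≤average {n} {p} {ρ} {κ} 0≤p p≤1 0≤ρ ρ≤1 g h = ≤-trans
  (≤-reflexive (sym (∑-*ˡ κ (λ U → 𝟙 (not (AND U (frequent p κ g))) * F ρ U h))))
  (≤-trans (∑-mono 0≤1 0≤1 below)
    (≤-reflexive (trans (sym (∑-swap (λ x U → 𝟙 (g x) * (𝟙 (not (AND U x)) * F ρ U h))))
      (∑-cong (λ x → ∑-*ˡ (𝟙 (g x)) (λ U → 𝟙 (not (AND U x)) * F ρ U h))))))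
  where
  F≥0 : ∀ U → 0ℚ ≤ F ρ U h
  F≥0 U = F-nonneg 0≤ρ ρ≤1 U h
  below : ∀ U → κ * (𝟙 (not (AND U (frequent p κ g))) * F ρ U h)
              ≤ E p (λ x → 𝟙 (g x) * (𝟙 (not (AND U x)) * F ρ U h))
  below U with AND U (frequent p κ g) in U⊈T
  ... | true = ≤-trans (≤-reflexive (solve 2 (λ k a → k :* (con 0ℚ :* a) := con 0ℚ) refl κ (F ρ U h)))
    (E-nonneg 0≤p p≤1 (λ x → 0≤* (0≤𝟙 (g x)) (0≤* (0≤𝟙 (not (AND U x))) (F≥0 U))))
  ... | false with AND-witness U (frequent p κ g) U⊈T
  ... | j , Uj , Tj = ≤-trans
    (≤-reflexive (solve 2 (λ k a → k :* (con 1ℚ :* a) := a :* k) refl κ (F ρ U h)))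
    (≤-trans (*-monoʳ-≤ (F≥0 U) (frequent-false p κ g j Tj))
      (≤-trans (≤-reflexive (sym (∑-*ˡ (F ρ U h) (λ x → 𝟙 (not (lookup x j)) * 𝟙 (g x)))))
        (E-mono 0≤p p≤1 (λ x → ≤-trans
          (≤-reflexive (solve 3 (λ f l k → f :* (l :* k) := (k :* f) :* l) refl (F ρ U h) (𝟙 (not (lookup x j))) (𝟙 (g x))))
          (≤-trans (*-monoʳ-≤ (0≤* (0≤𝟙 (g x)) (F≥0 U))
              (𝟙-antitone (lookup x j) (AND U x) (AND-lookup U x j Uj)))
            (≤-reflexive (solve 3 (λ f l k → (k :* f) :* l := k :* (l :* f)) refl (F ρ U h) (𝟙 (not (AND U x))) (𝟙 (g x)))))))))

disagree : ∀ {n} → (f g h : BoolFun n) → Cube n → Cube n → ℚ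
disagree f g h x y = 𝟙 (not (f (x ⋀ y) ==ᵇ (g x ∧ h y)))

-- When `g x = 1`, the function `f (x ⋀ y)` of `y` is a competitor in `W≤distance`, and its squared
-- distance from `h` is the probability of disagreement at `x`.
average≤disagreement : ∀ {n} {p ρ} → 0ℚ ≤ p → 0ℚ ≤ 1ℚ - p → 0ℚ ≤ ρ → 0ℚ ≤ 1ℚ - ρ → (f g h : BoolFun n) →
  E p (λ x → 𝟙 (g x) * W ρ x (λ y → 𝟙 (h y))) ≤ E p (λ x → E ρ (disagree f g h x))
average≤disagreement {n} {p} {ρ} 0≤p p≤1 0≤ρ ρ≤1 f g h = E-mono 0≤p p≤1 at
  where
  sq : ∀ a b → (𝟙 b - 𝟙 a) * (𝟙 b - 𝟙 a) ≤ 𝟙 (not (a ==ᵇ b))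
  sq true  true  = ≤ᵇ⇒≤ tt
  sq true  false = ≤ᵇ⇒≤ tt
  sq false true  = ≤ᵇ⇒≤ tt
  sq false false = ≤ᵇ⇒≤ tt
  at : ∀ x → 𝟙 (g x) * W ρ x (λ y → 𝟙 (h y)) ≤ E ρ (disagree f g h x)
  at x with g x
  ... | true  = ≤-trans (≤-reflexive (*-identityˡ (W ρ x (λ y → 𝟙 (h y)))))
    (≤-trans (W≤distance 0≤ρ ρ≤1 x (λ y → 𝟙 (h y)) (λ z → 𝟙 (f z)))
      (E-mono 0≤ρ ρ≤1 (λ y → sq (f (x ⋀ y)) (h y))))
  ... | false = ≤-trans (≤-reflexive (*-zeroˡ (W ρ x (λ y → 𝟙 (h y)))))
    (E-nonneg 0≤ρ ρ≤1 (λ y → 0≤𝟙 (not (f (x ⋀ y) ==ᵇ false))))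

⋀-comm : ∀ {n} (x y : Cube n) → x ⋀ y ≡ y ⋀ x
⋀-comm []      []      = refl
⋀-comm (a ∷ x) (b ∷ y) = cong₂ _∷_ (∧-comm a b) (⋀-comm x y)

-- Makes the hypothesis symmetric, so that the averaging argument also applies with `g` and `h`
-- exchanged.
disagreement-swap : ∀ {n} p ρ (f g h : BoolFun n) →
  E p (λ x → E ρ (disagree f g h x)) ≡ E ρ (λ y → E p (disagree f h g y))
disagreement-swap p ρ f g h = trans (∑-swap (disagree f g h))
  (∑-cong (λ y → ∑-cong (λ x → cong₂ (λ z b → 𝟙 (not (f z ==ᵇ b))) (⋀-comm x y) (∧-comm (g x) (h y)))))

-- Union bound, and closeness of one function to `AND`.

ι : ℕ → ℚ
ι zero    = 0ℚ
ι (suc n) = 1ℚ + ι n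

0≤ι : ∀ n → 0ℚ ≤ ι n
0≤ι zero    = ≤-refl
0≤ι (suc n) = 0≤+ 0≤1 (0≤ι n)

ι-mono : ∀ {m n} → m ℕ.≤ n → ι m ≤ ι n
ι-mono {n = n} ℕ.z≤n   = 0≤ι n
ι-mono (ℕ.s≤s m≤n) = +-monoʳ-≤ 1ℚ (ι-mono m≤n)

pow : ℚ → ℕ → ℚ
pow q zero    = 1ℚ
pow q (suc n) = q * pow q n

pow-nonneg : ∀ {q} → 0ℚ ≤ q → ∀ n → 0ℚ ≤ pow q n
pow-nonneg 0≤q zero    = 0≤1
pow-nonneg 0≤q (suc n) = 0≤* 0≤q (pow-nonneg 0≤q n)

R-1 : ∀ {n} q (T : Subset n) → R q T (λ _ → 1ℚ) ≡ pow q ∣ T ∣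
R-1 q []          = refl
R-1 q (true ∷ T)  = trans (R-true q T (λ _ → 1ℚ)) (cong (q *_) (R-1 q T))
R-1 q (false ∷ T) = trans (solve 2 (λ q a → (con 1ℚ :- q) :* a :+ q :* a := a) refl q (R q T (λ _ → 1ℚ))) (R-1 q T)

subset-of-size : ∀ {n} m (T : Subset n) → m ℕ.≤ ∣ T ∣ →
  ∃[ V ] (∣ V ∣ ≡ m × (∀ j → lookup V j ≡ true → lookup T j ≡ true))
subset-of-size {n} zero T _ = ⊥ , ∣⊥∣≡0 n , λ j Vj → absurd (trans (sym Vj) (lookup-replicate j false))
  where
  absurd : ∀ {A : Set} → true ≡ false → A
  absurd ()
subset-of-size (suc m) (true ∷ T) (ℕ.s≤s m≤T) with subset-of-size m T m≤T
... | V , size , V⊆T = true ∷ V , cong suc size , λ { zero _ → refl ; (suc j) → V⊆T j }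
subset-of-size (suc m) (false ∷ T) m≤T with subset-of-size (suc m) T m≤T
... | V , size , V⊆T = false ∷ V , size , λ { (suc j) → V⊆T j }

module _ {q : ℚ} (0≤q : 0ℚ ≤ q) (q≤1 : 0ℚ ≤ 1ℚ - q) where

  -- The projection π lets the induction drop coordinates of T without changing the measure on the cube.
  union-bound : ∀ {m n} {κ} (π : Cube n → Cube m) (T : Subset m) {φ : Cube n → ℚ} → (∀ x → 0ℚ ≤ φ x) →
    (∀ j → lookup T j ≡ true → E q (λ x → 𝟙 (not (lookup (π x) j)) * φ x) ≤ κ) →
    E q (λ x → 𝟙 (not (AND T (π x))) * φ x) ≤ ι ∣ T ∣ * κ
  union-bound {n = n} {κ} π [] {φ} 0≤φ _ = ≤-reflexive (trans
    (∑-cong (λ x → trans (cong (λ b → 𝟙 (not b) * φ x) (nil (π x))) (*-zeroˡ (φ x))))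
    (trans (∑-zero n) (sym (*-zeroˡ κ))))
    where
    nil : (y : Cube 0) → AND [] y ≡ true
    nil [] = refl
  union-bound {n = n} {κ} π (t ∷ T) {φ} 0≤φ rare = split t (rare zero)
    where
    π' : Cube n → Cube _
    π' x = tail (π x)
    tail-lookup : ∀ {m} (y : Cube (suc m)) j → lookup y (suc j) ≡ lookup (tail y) j
    tail-lookup (b ∷ y) j = refl
    rest : E q (λ x → 𝟙 (not (AND T (π' x))) * φ x) ≤ ι ∣ T ∣ * κ
    rest = union-bound π' T 0≤φ (λ j Tj → subst (_≤ κ)
      (∑-cong (λ x → cong (λ b → 𝟙 (not b) * φ x) (tail-lookup (π x) j))) (rare (suc j) Tj))
    skip : ∀ y → AND (false ∷ T) y ≡ AND T (tail y)
    skip (b ∷ y) = refl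
    cover : ∀ y → 𝟙 (not (AND (true ∷ T) y)) ≤ 𝟙 (not (lookup y zero)) + 𝟙 (not (AND T (tail y)))
    cover (true ∷ y)  = ≤-reflexive (sym (+-identityˡ (𝟙 (not (AND T y)))))
    cover (false ∷ y) = ≤-by (0≤𝟙 (not (AND T y))) refl
    split : ∀ t → (t ≡ true → E q (λ x → 𝟙 (not (lookup (π x) zero)) * φ x) ≤ κ) →
      E q (λ x → 𝟙 (not (AND (t ∷ T) (π x))) * φ x) ≤ ι ∣ t ∷ T ∣ * κ
    split false _    = subst (_≤ ι ∣ T ∣ * κ) (∑-cong (λ x → cong (λ b → 𝟙 (not b) * φ x) (sym (skip (π x))))) rest
    split true  head = ≤-trans
      (E-mono 0≤q q≤1 (λ x → subst (𝟙 (not (AND (true ∷ T) (π x))) * φ x ≤_)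
        (*-distribʳ-+ (φ x) (𝟙 (not (lookup (π x) zero))) (𝟙 (not (AND T (π' x)))))
        (*-monoʳ-≤-nonNeg (φ x) {{nonNegative (0≤φ x)}} (cover (π x)))))
      (≤-trans (≤-reflexive (∑-+ (λ x → 𝟙 (not (lookup (π x) zero)) * φ x) (λ x → 𝟙 (not (AND T (π' x))) * φ x)))
        (≤-trans (+-mono-≤ (head refl) rest)
          (≤-reflexive (solve 2 (λ k i → k :+ i :* k := (con 1ℚ :+ i) :* k) refl κ (ι ∣ T ∣)))))

  R-complement : ∀ {n} (T : Subset n) φ → E q φ ≡ R q T φ + E q (λ x → 𝟙 (not (AND T x)) * φ x)
  R-complement {n} T φ = trans (∑-cong (λ x → 𝟙-+ (AND T x) (φ x))) (∑-+ {n} _ _)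

  𝟙≤1 : ∀ b → 𝟙 b ≤ 1ℚ
  𝟙≤1 true  = ≤-refl
  𝟙≤1 false = 0≤1

  E≤pow+miss : ∀ {n} (T : Subset n) (g : BoolFun n) →
    E q (λ x → 𝟙 (g x)) ≤ pow q ∣ T ∣ + E q (λ x → 𝟙 (not (AND T x)) * 𝟙 (g x))
  E≤pow+miss T g = ≤-trans (≤-reflexive (R-complement T (λ x → 𝟙 (g x))))
    (+-monoˡ-≤ _ (≤-trans (E-mono 0≤q q≤1 (λ x → *-monoʳ-≤ (0≤𝟙 (AND T x)) (𝟙≤1 (g x)))) (≤-reflexive (R-1 q T))))

  -- If the frequent set had `m` or more elements, a union bound over exactly `m` of them would give
  -- `E` of `g` at most `pow q m + ι m * κ`, against `big`. So it has at most `m` elements, and the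
  -- union bound over all of them costs `ι m * κ`, whatever `n` is.
  miss≤ : ∀ {n} {κ} m (g : BoolFun n) → 0ℚ ≤ κ → pow q m + ι m * κ < E q (λ x → 𝟙 (g x)) →
    E q (λ x → 𝟙 (not (AND (frequent q κ g) x)) * 𝟙 (g x)) ≤ ι m * κ
  miss≤ {n} {κ} m g 0≤κ big with ℕₚ.≤-total m ∣ frequent q κ g ∣
  ... | inj₂ T≤m = ≤-trans
    (union-bound (λ x → x) (frequent q κ g) (λ x → 0≤𝟙 (g x)) (λ j → frequent-true q κ g j))
    (*-monoʳ-≤-nonNeg κ {{nonNegative 0≤κ}} (ι-mono T≤m))
  ... | inj₁ m≤T with subset-of-size m (frequent q κ g) m≤T
  ... | V , refl , V⊆T = ⊥-elim (<-irrefl refl (<-≤-trans big (≤-trans (E≤pow+miss V g)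
    (+-monoʳ-≤ (pow q ∣ V ∣) (union-bound (λ x → x) V (λ x → 0≤𝟙 (g x)) (λ j Vj → frequent-true q κ g j (V⊆T j Vj)))))))

  -- If `j` is frequent for `h` but outside `T`, the covariance of `h` with `x_j = 0` is at most
  -- `κ - 2κ`. The component at `⁅ j ⁆` is then at least `κ * κ`, yet it is counted in `W`, which is
  -- too small for that.
  frequent⊆ : ∀ {n} {κ η} (T : Subset n) (h : BoolFun n) → 0ℚ ≤ κ → κ * W q T (λ x → 𝟙 (h x)) ≤ η → η < κ * (κ * κ) →
    κ + κ ≤ (1ℚ - q) * E q (λ x → 𝟙 (h x)) → ∀ j → lookup (frequent q κ h) j ≡ true → lookup T j ≡ true
  frequent⊆ {κ = κ} T h 0≤κ W≤ η< 2κ≤ j Hj with lookup T j in Tj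
  ... | true  = refl
  ... | false = ⊥-elim (<-irrefl refl (≤-<-trans (≤-trans (*-monoʳ-≤ 0≤κ (≤-trans κκ≤ (≤-trans (F-singleton 0≤q q≤1 j h') F≤W))) W≤) η<))
    where
    h' : Cube _ → ℚ
    h' x = 𝟙 (h x)
    e m : ℚ
    e = E q (λ x → 𝟙 (not (lookup x j)) * h' x)
    m = (1ℚ - q) * E q h'
    κ≤ : κ ≤ m - e
    κ≤ = ≤-by (0≤+ (0≤- 2κ≤) (0≤- (frequent-true q κ h j Hj)))
      (solve 3 (λ k m e → m :- e := k :+ ((m :- (k :+ k)) :+ (k :- e))) refl κ m e)
    κκ≤ : κ * κ ≤ (e - m) * (e - m)
    κκ≤ = ≤-trans (*-mono-≤ 0≤κ 0≤κ κ≤ κ≤) (≤-reflexive (solve 2 (λ m e → (m :- e) :* (m :- e) := (e :- m) :* (e :- m)) refl m e))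
    j∉T : AND ⁅ j ⁆ T ≡ false
    j∉T with AND ⁅ j ⁆ T in eq
    ... | false = refl
    ... | true with () ← trans (sym (AND-lookup ⁅ j ⁆ T j ([]=⇒lookup (x∈⁅x⁆ j)) eq)) Tj
    F≤W : F q ⁅ j ⁆ h' ≤ W q T h'
    F≤W = ≤-trans
      (≤-reflexive (trans (sym (*-identityˡ (F q ⁅ j ⁆ h'))) (cong (λ b → 𝟙 (not b) * F q ⁅ j ⁆ h') (sym j∉T))))
      (term≤S (λ U → 0≤* (0≤𝟙 (not (AND U T))) (F-nonneg 0≤q q≤1 U h')) ⁅ j ⁆)

  -- A near `T`-junta is nearly constant on the subcube. If `a` and `b` are the masses there of
  -- `h = 1` and `h = 0`, `R-variance≤W` gives `a * b ≤ W`, so they cannot both reach `κ`.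
  R-deficit≤ : ∀ {n} {κ η} (T : Subset n) (h : BoolFun n) → 0ℚ ≤ κ → κ * W q T (λ x → 𝟙 (h x)) ≤ η → η < κ * (κ * κ) →
    κ ≤ R q T (λ x → 𝟙 (h x)) → R q T (λ x → 1ℚ - 𝟙 (h x)) ≤ κ
  R-deficit≤ {n} {κ} T h 0≤κ W≤ η< κ≤a with ≤-total κ (R q T (λ x → 1ℚ - 𝟙 (h x)))
  ... | inj₂ b≤κ = b≤κ
  ... | inj₁ κ≤b = ⊥-elim (<-irrefl refl (≤-<-trans (≤-trans (*-monoʳ-≤ 0≤κ (≤-trans (*-mono-≤ 0≤κ 0≤κ κ≤a κ≤b) ab≤W)) W≤) η<))
    where
    h' : Cube n → ℚ
    h' x = 𝟙 (h x)
    a b r : ℚ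
    a = R q T h'
    b = R q T (λ x → 1ℚ - h' x)
    r = R q T (λ _ → 1ℚ)
    𝟙-idem : ∀ b → 𝟙 b * 𝟙 b ≡ 𝟙 b
    𝟙-idem true  = refl
    𝟙-idem false = refl
    b≡r-a : b ≡ r - a
    b≡r-a = trans (∑-cong (λ x → solve 2 (λ w c → w :* (con 1ℚ :- c) := w :* con 1ℚ :- w :* c) refl (𝟙 (AND T x)) (h' x))) (∑-sub {n} _ _)
    ra≤ : r * a ≤ a * a + W q T h'
    ra≤ = subst (λ c → r * c ≤ a * a + W q T h')
      (∑-cong (λ x → cong (𝟙 (AND T x) *_) (𝟙-idem (h x)))) (R-variance≤W 0≤q q≤1 T h')
    ab≤W : a * b ≤ W q T h'
    ab≤W = ≤-by (0≤- ra≤) (trans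
      (solve 3 (λ a r w → w := a :* (r :- a) :+ (a :* a :+ w :- r :* a)) refl a r (W q T h'))
      (cong (λ b → a * b + (a * a + W q T h' - r * a)) (sym b≡r-a)))

  -- The differences are `h = 1` off the subcube, bounded by `miss≤`, and `h = 0` on it, bounded by
  -- `R-deficit≤`. The latter applies because removing the missed mass from `h` leaves at least `κ`
  -- on the subcube.
  close-to-AND : ∀ {n} {κ η} m (h : BoolFun n) → 0ℚ ≤ κ → κ * W q (frequent q κ h) (λ x → 𝟙 (h x)) ≤ η → η < κ * (κ * κ) →
    pow q m + ι m * κ < E q (λ x → 𝟙 (h x)) → ι m * κ + κ ≤ E q (λ x → 𝟙 (h x)) →
    E q (λ x → 𝟙 (not (h x ==ᵇ AND (frequent q κ h) x))) ≤ ι m * κ + κ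
  close-to-AND {n} {κ} m h 0≤κ W≤ η< big mκ+κ≤ = ≤-trans
    (≤-reflexive (trans (∑-cong (λ x → cases (h x) (AND T' x))) (∑-+ {n} _ _)))
    (+-mono-≤ missed (R-deficit≤ T' h 0≤κ W≤ η< κ≤R))
    where
    T' : Subset n
    T' = frequent q κ h
    missed : E q (λ x → 𝟙 (not (AND T' x)) * 𝟙 (h x)) ≤ ι m * κ
    missed = miss≤ m h 0≤κ big
    κ≤R : κ ≤ R q T' (λ x → 𝟙 (h x))
    κ≤R = ≤-by (0≤+ (0≤- mκ+κ≤) (0≤- missed)) (trans
      (solve 4 (λ r d i k → r := k :+ ((r :+ d :- (i :+ k)) :+ (i :- d))) refl
        (R q T' (λ x → 𝟙 (h x))) (E q (λ x → 𝟙 (not (AND T' x)) * 𝟙 (h x))) (ι m * κ) κ)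
      (cong (λ e → κ + ((e - (ι m * κ + κ)) + (ι m * κ - E q (λ x → 𝟙 (not (AND T' x)) * 𝟙 (h x)))))
        (sym (R-complement T' (λ x → 𝟙 (h x))))))
    cases : ∀ a b → 𝟙 (not (a ==ᵇ b)) ≡ 𝟙 (not b) * 𝟙 a + 𝟙 b * (1ℚ - 𝟙 a)
    cases true  true  = refl
    cases true  false = refl
    cases false true  = refl
    cases false false = refl

lookup-antisym : ∀ {n} (T V : Subset n) → (∀ j → lookup T j ≡ true → lookup V j ≡ true) →
  (∀ j → lookup V j ≡ true → lookup T j ≡ true) → T ≡ V
lookup-antisym T V T⊆V V⊆T = trans (sym (tabulate∘lookup T)) (trans (tabulate-cong agree) (tabulate∘lookup V))
  where
  agree : ∀ j → lookup T j ≡ lookup V j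
  agree j with lookup T j in Tj | lookup V j in Vj
  ... | true  | true  = refl
  ... | false | false = refl
  ... | true  | false = trans (sym (T⊆V j Tj)) Vj
  ... | false | true  = trans (sym Tj) (V⊆T j Vj)

-- From list sums to expectations.

sumℚ-++ : ∀ {A B : Set} (ψ : B → ℚ) (u v : A → B) (xs : List A) →
  sumℚ (map ψ (concatMap (λ x → u x ∷ v x ∷ []) xs)) ≡ sumℚ (map (λ x → ψ (u x)) xs) + sumℚ (map (λ x → ψ (v x)) xs)
sumℚ-++ ψ u v []       = refl
sumℚ-++ ψ u v (x ∷ xs) = trans (cong (λ s → ψ (u x) + (ψ (v x) + s)) (sumℚ-++ ψ u v xs))
  (solve 4 (λ a b s t → a :+ (b :+ (s :+ t)) := (a :+ s) :+ (b :+ t)) refl (ψ (u x)) (ψ (v x)) _ _)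

sumℚ-cube : ∀ {n} (ψ : Cube n → ℚ) → sumℚ (map ψ (cube n)) ≡ S ψ
sumℚ-cube {zero}  ψ = +-identityʳ (ψ [])
sumℚ-cube {suc n} ψ = trans (sumℚ-++ ψ (false ∷_) (true ∷_) (cube n)) (cong₂ _+_
  (trans (sumℚ-cube (λ x → ψ (false ∷ x))) (sym (*-identityˡ (S (λ x → ψ (false ∷ x))))))
  (trans (sumℚ-cube (λ x → ψ (true ∷ x))) (sym (*-identityˡ (S (λ x → ψ (true ∷ x)))))))

S-μ : ∀ {n} q (φ : Cube n → ℚ) → S (λ x → μ q x * φ x) ≡ E q φ
S-μ {zero}  q φ = *-identityˡ (φ [])
S-μ {suc n} q φ = cong₂ _+_ (half (1ℚ - q) false) (half q true)
  where
  half : ∀ c b → 1ℚ * S (λ x → c * μ q x * φ (b ∷ x)) ≡ c * E q (λ x → φ (b ∷ x))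
  half c b = trans (*-identityˡ (S (λ x → c * μ q x * φ (b ∷ x)))) (trans
    (trans (∑-cong (λ x → *-assoc c (μ q x) (φ (b ∷ x)))) (∑-*ˡ c (λ x → μ q x * φ (b ∷ x))))
    (cong (c *_) (S-μ q (λ x → φ (b ∷ x)))))

Pr≡E : ∀ {n} q (P : Cube n → Bool) → Pr q P ≡ E q (λ x → 𝟙 (P x))
Pr≡E q P = trans (sumℚ-cube (λ x → μ q x * 𝟙 (P x))) (S-μ q (λ x → 𝟙 (P x)))

agreement+disagreement : ∀ {n} p ρ (f g h : BoolFun n) →
  agreement p ρ f g h + E p (λ x → E ρ (disagree f g h x)) ≡ 1ℚ
agreement+disagreement {n} p ρ f g h = trans
  (cong (_+ E p (λ x → E ρ (disagree f g h x))) agreement≡E)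
  (trans (sym (∑-+ (λ x → E ρ (agree x)) (λ x → E ρ (disagree f g h x)))) (trans
    (∑-cong (λ x → trans (sym (∑-+ (agree x) (disagree f g h x)))
      (trans (∑-cong (λ y → 𝟙+𝟙not (f (x ⋀ y) ==ᵇ (g x ∧ h y)))) (E-const n ρ 1ℚ))))
    (E-const n p 1ℚ)))
  where
  agree : Cube n → Cube n → ℚ
  agree x y = 𝟙 (f (x ⋀ y) ==ᵇ (g x ∧ h y))
  𝟙+𝟙not : ∀ b → 𝟙 b + 𝟙 (not b) ≡ 1ℚ
  𝟙+𝟙not true  = refl
  𝟙+𝟙not false = refl
  inner : ∀ x → sumℚ (map (λ y → μ p x * μ ρ y * agree x y) (cube n)) ≡ μ p x * E ρ (agree x)
  inner x = trans (sumℚ-cube (λ y → μ p x * μ ρ y * agree x y)) (trans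
    (∑-cong (λ y → *-assoc (μ p x) (μ ρ y) (agree x y)))
    (trans (∑-*ˡ (μ p x) (λ y → μ ρ y * agree x y)) (cong (μ p x *_) (S-μ ρ (agree x)))))
  agreement≡E : agreement p ρ f g h ≡ E p (λ x → E ρ (agree x))
  agreement≡E = trans (sumℚ-cube (λ x → sumℚ (map (λ y → μ p x * μ ρ y * agree x y) (cube n))))
    (trans (∑-cong inner) (S-μ p (λ x → E ρ (agree x))))

-- Coordinate by coordinate: of the four pairs of bits only (1,1), of probability `ρ * p`, yields 1.
E-⋀ : ∀ {n} p ρ (φ : Cube n → ℚ) → E p (λ x → E ρ (λ y → φ (x ⋀ y))) ≡ E (ρ * p) φ
E-⋀ {zero}  p ρ φ = refl
E-⋀ {suc n} p ρ φ = trans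
  (cong₂ (λ u v → (1ℚ - p) * u + p * v)
    (trans (E-mean {n} p ρ _ _) (cong₂ (λ u v → (1ℚ - ρ) * u + ρ * v) (E-⋀ p ρ (λ x → φ (false ∷ x))) (E-⋀ p ρ (λ x → φ (false ∷ x)))))
    (trans (E-mean {n} p ρ _ _) (cong₂ (λ u v → (1ℚ - ρ) * u + ρ * v) (E-⋀ p ρ (λ x → φ (false ∷ x))) (E-⋀ p ρ (λ x → φ (true ∷ x))))))
  (solve 4 (λ p r u v → (con 1ℚ :- p) :* ((con 1ℚ :- r) :* u :+ r :* u) :+ p :* ((con 1ℚ :- r) :* u :+ r :* v)
     := (con 1ℚ :- r :* p) :* u :+ r :* p :* v) refl p ρ (E (ρ * p) (λ x → φ (false ∷ x))) (E (ρ * p) (λ x → φ (true ∷ x))))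

-- Choice of the constants.

archimedean : ∀ r → 0ℚ < r → ∃[ m ] 1ℚ ≤ ι m * r
-- `d` stores the denominator minus one, so `suc d` times `r` is its numerator `suc a`, at least 1.
archimedean r@(mkℚ (ℤ.+ suc a) d _) _ = suc d , toℚᵘ-cancel-≤
  (ℚᵘₚ.≤-trans one≤ (ℚᵘₚ.≤-reflexive (ℚᵘₚ.≃-sym (ℚᵘₚ.≃-trans (toℚᵘ-homo-* (ι (suc d)) r) (ℚᵘₚ.*-congʳ {toℚᵘ r} (toℚᵘ-ι (suc d)))))))
  where
  toℚᵘ-ι : ∀ n → toℚᵘ (ι n) ℚᵘ.≃ mkℚᵘ (ℤ.+ n) 0
  toℚᵘ-ι zero    = ℚᵘₚ.≃-refl
  toℚᵘ-ι (suc n) = ℚᵘₚ.≃-trans (toℚᵘ-homo-+ 1ℚ (ι n)) (ℚᵘₚ.≃-trans (ℚᵘₚ.+-congʳ (toℚᵘ 1ℚ) (toℚᵘ-ι n))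
    (*≡* (cong (λ i → (ℤ.+ 1 ℤ.+ i) ℤ.* ℤ.+ 1) (ℤₚ.*-identityʳ (ℤ.+ n)))))
  one≤ : toℚᵘ 1ℚ ℚᵘ.≤ mkℚᵘ (ℤ.+ suc d) 0 ℚᵘ.* toℚᵘ r
  one≤ = *≤* (ℤ.+≤+ (ℕₚ.≤-trans (ℕₚ.≤-reflexive (trans (ℕₚ.+-identityʳ _) (ℕₚ.+-identityʳ (suc d))))
    (ℕₚ.≤-trans (ℕₚ.m≤m*n (suc d) (suc a)) (ℕₚ.≤-reflexive (sym (ℕₚ.*-identityʳ _))))))
archimedean (mkℚ (ℤ.+ zero) d _) (*<* (ℤ.+<+ ()))
archimedean (mkℚ ℤ.-[1+ _ ] d _) (*<* ())

-- Gives decay of `pow p m` uniform in `p` without logarithms. The induction rests on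
-- `(1 - ζ)(1 + (m+1)ζ) = 1 + mζ - (m+1)ζ²`.
bernoulli : ∀ {ζ p} → 0ℚ ≤ ζ → 0ℚ ≤ p → p ≤ 1ℚ - ζ → ∀ m → pow p m * (1ℚ + ι m * ζ) ≤ 1ℚ
bernoulli {ζ} _ _ _ zero = ≤-reflexive (solve 1 (λ z → con 1ℚ :* (con 1ℚ :+ con 0ℚ :* z) := con 1ℚ) refl ζ)
bernoulli {ζ} {p} 0≤ζ 0≤p p≤ (suc m) = ≤-by
  (0≤+ (0≤- (bernoulli 0≤ζ 0≤p p≤ m)) (0≤* (pow-nonneg 0≤p m)
    (0≤+ (0≤* (0≤- p≤) (0≤+ 0≤1 (0≤* (0≤ι (suc m)) 0≤ζ))) (0≤* (0≤² ζ) (0≤ι (suc m))))))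
  (solve 4 (λ z p P i → con 1ℚ := p :* P :* (con 1ℚ :+ (con 1ℚ :+ i) :* z)
     :+ ((con 1ℚ :- P :* (con 1ℚ :+ i :* z)) :+ P :* ((con 1ℚ :- z :- p) :* (con 1ℚ :+ (con 1ℚ :+ i) :* z) :+ z :* z :* (con 1ℚ :+ i))))
    refl ζ p (pow p m) (ι m))

0<½ : 0ℚ < ½
0<½ = positive⁻¹ ½

0<+ : ∀ {a b} → 0ℚ < a → 0ℚ < b → 0ℚ < a + b
0<+ = +-mono-<

pow-small : ∀ {ζ a} → 0ℚ < ζ → 0ℚ < a → ∃[ m ] (∀ p → 0ℚ ≤ p → p ≤ 1ℚ - ζ → pow p m + pow p m ≤ a)
-- This `m` has `ι m * ζ * a ≥ 2`; multiplying `bernoulli` by `a` then bounds twice the power by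
-- `a`.
pow-small {ζ} {a} 0<ζ 0<a with archimedean (ζ * a * ½) (0<* (0<* 0<ζ 0<a) 0<½)
... | m , 1≤ = m , λ p 0≤p p≤ → let P = pow p m ; P≥0 = pow-nonneg 0≤p m in ≤-by
  (0≤+ (0≤* (<⇒≤ 0<a) (0≤- (bernoulli (<⇒≤ 0<ζ) 0≤p p≤ m))) (0≤+ (0≤* (<⇒≤ 0<a) P≥0) (0≤* (0≤+ P≥0 P≥0) (0≤- 1≤))))
  (solve 4 (λ z a P i → a := (P :+ P) :+ (a :* (con 1ℚ :- P :* (con 1ℚ :+ i :* z)) :+ (a :* P :+ (P :+ P) :* (i :* (z :* a :* con ½) :- con 1ℚ))))
    refl ζ a P (ι m))

smaller : ∀ {u v} → 0ℚ < u → 0ℚ < v → ∃[ w ] (0ℚ < w × w ≤ u × w ≤ v)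
smaller {u} {v} 0<u 0<v with ≤-total u v
... | inj₁ u≤v = u , 0<u , ≤-refl , u≤v
... | inj₂ v≤u = v , 0<v , v≤u , ≤-refl

fraction : ∀ {c v} → 0ℚ < c → 0ℚ < v → ∃[ w ] (0ℚ < w × c * w ≤ v)
fraction {c} {v} 0<c 0<v = v * 1/ c , 0<* 0<v (positive⁻¹ (1/ c) {{1/pos⇒pos c}}) , ≤-reflexive (trans
  (solve 3 (λ c v i → c :* (v :* i) := v :* (c :* i)) refl c v (1/ c))
  (trans (cong (v *_) (*-inverseʳ c)) (*-identityʳ v)))
  where
  instance
    c⁺ : Positive c
    c⁺ = positive 0<c
    c≠0 : NonZero c
    c≠0 = pos⇒nonZero c

small-κ : ∀ {i b a} → 0ℚ ≤ i → 0ℚ < b → 0ℚ < a →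
  ∃[ κ ] (0ℚ < κ × κ ≤ 1ℚ × κ + κ ≤ b × (i * κ + i * κ) + (κ + κ + κ) ≤ a)
small-κ {i} {b} {a} 0≤i 0<b 0<a =
  let w , 0<w , cw≤a = fraction 0<c 0<a
      v , 0<v , v≤1 , v≤ = smaller (positive⁻¹ 1ℚ) (0<* 0<½ 0<b)
      κ , 0<κ , κ≤w , κ≤v = smaller 0<w 0<v
  in κ , 0<κ , ≤-trans κ≤v v≤1 ,
     ≤-trans (+-mono-≤ (≤-trans κ≤v v≤) (≤-trans κ≤v v≤)) (≤-reflexive (halves b)) ,
     ≤-trans (≤-reflexive (factor κ)) (≤-trans (*-monoʳ-≤ (<⇒≤ 0<c) κ≤w) cw≤a)
  where
  c : ℚ
  c = i + i + (1ℚ + 1ℚ + 1ℚ)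
  0<c : 0ℚ < c
  0<c = <-≤-trans (0<+ (0<+ (positive⁻¹ 1ℚ) (positive⁻¹ 1ℚ)) (positive⁻¹ 1ℚ)) (≤-by (0≤+ 0≤i 0≤i) (+-comm (i + i) (1ℚ + 1ℚ + 1ℚ)))
  halves : ∀ b → ½ * b + ½ * b ≡ b
  halves = solve 1 (λ b → con ½ :* b :+ con ½ :* b := b) refl
  factor : ∀ κ → (i * κ + i * κ) + (κ + κ + κ) ≡ c * κ
  factor κ = solve 2 (λ k i → (i :* k :+ i :* k) :+ (k :+ k :+ k) := (i :+ i :+ (con 1ℚ :+ con 1ℚ :+ con 1ℚ)) :* k) refl κ i

-- `m` comes first, since `κ` must be small against it. `κ ≤ 1ℚ` makes a multiple of `κ³` at most
-- `κ`; the bound by `ζ * a` feeds `frequent⊆`; the next one is the error budget, with `3κ` also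
-- providing strictness.
constants : ∀ {ζ a} → 0ℚ < ζ → 0ℚ < a → ∃[ m ] ∃[ κ ] (0ℚ < κ × κ ≤ 1ℚ × κ + κ ≤ ζ * a
  × (ι m * κ + ι m * κ) + (κ + κ + κ) ≤ a × (∀ p → 0ℚ ≤ p → p ≤ 1ℚ - ζ → pow p m + pow p m ≤ a))
constants 0<ζ 0<a =
  let m , pow≤ = pow-small 0<ζ 0<a
      κ , 0<κ , κ≤1 , 2κ≤ , 2mκ+3κ≤ = small-κ (0≤ι m) (0<* 0<ζ 0<a) 0<a
  in m , κ , 0<κ , κ≤1 , 2κ≤ , 2mκ+3κ≤ , pow≤

-- Transfer to `f` and assembly.

-- The route from bounds on `g` and `h` under their own measures to `f`, whose input `x ⋀ y` has law
-- `μ (ρ * p)`.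
E-⋀≤ : ∀ {n} {p ρ} → 0ℚ ≤ p → 0ℚ ≤ 1ℚ - p → 0ℚ ≤ ρ → 0ℚ ≤ 1ℚ - ρ → (f g h : BoolFun n) (φ u v : Cube n → ℚ) →
  (∀ x y → φ (x ⋀ y) ≤ disagree f g h x y + (u x + v y)) →
  E (ρ * p) φ ≤ E p (λ x → E ρ (disagree f g h x)) + (E p u + E ρ v)
E-⋀≤ {n} {p} {ρ} 0≤p p≤1 0≤ρ ρ≤1 f g h φ u v le = ≤-trans (≤-reflexive (sym (E-⋀ p ρ φ)))
  (≤-trans (E-mono 0≤p p≤1 (λ x → E-mono 0≤ρ ρ≤1 (le x)))
    (≤-reflexive (trans
      (∑-cong (λ x → trans (∑-+ (disagree f g h x) (λ y → u x + v y))
        (cong (E ρ (disagree f g h x) +_) (trans (∑-+ (λ _ → u x) v) (cong (_+ E ρ v) (E-const n ρ (u x)))))))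
      (trans (∑-+ (λ x → E ρ (disagree f g h x)) (λ x → u x + E ρ v))
        (cong (E p (λ x → E ρ (disagree f g h x)) +_) (trans (∑-+ u (λ _ → E ρ v)) (cong (E p u +_) (E-const n p (E ρ v)))))))))

differ-triangle : ∀ a b c → 𝟙 (not (a ==ᵇ c)) ≤ 𝟙 (not (a ==ᵇ b)) + 𝟙 (not (b ==ᵇ c))
differ-triangle true  true  true  = ≤ᵇ⇒≤ tt
differ-triangle true  true  false = ≤ᵇ⇒≤ tt
differ-triangle true  false true  = ≤ᵇ⇒≤ tt
differ-triangle true  false false = ≤ᵇ⇒≤ tt
differ-triangle false true  true  = ≤ᵇ⇒≤ tt
differ-triangle false true  false = ≤ᵇ⇒≤ tt
differ-triangle false false true  = ≤ᵇ⇒≤ tt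
differ-triangle false false false = ≤ᵇ⇒≤ tt

differ-∧ˡ : ∀ a b c → 𝟙 (not ((a ∧ b) ==ᵇ (c ∧ b))) ≤ 𝟙 (not (a ==ᵇ c))
differ-∧ˡ true  b     true  = ≤-reflexive (cong (λ e → 𝟙 (not e)) (refl-==ᵇ b))
  where
  refl-==ᵇ : ∀ b → b ==ᵇ b ≡ true
  refl-==ᵇ true  = refl
  refl-==ᵇ false = refl
differ-∧ˡ true  true  false = ≤ᵇ⇒≤ tt
differ-∧ˡ true  false false = ≤ᵇ⇒≤ tt
differ-∧ˡ false true  true  = ≤ᵇ⇒≤ tt
differ-∧ˡ false false true  = ≤ᵇ⇒≤ tt
differ-∧ˡ false b     false = ≤ᵇ⇒≤ tt

differ-∧ : ∀ a b c d → 𝟙 (not ((a ∧ b) ==ᵇ (c ∧ d))) ≤ 𝟙 (not (a ==ᵇ c)) + 𝟙 (not (b ==ᵇ d))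
differ-∧ a b c d = ≤-trans (differ-triangle (a ∧ b) (c ∧ b) (c ∧ d)) (+-mono-≤ (differ-∧ˡ a b c)
  (subst₂ (λ s t → 𝟙 (not (s ==ᵇ t)) ≤ 𝟙 (not (b ==ᵇ d))) (∧-comm b c) (∧-comm d c) (differ-∧ˡ b c d)))

differ-false : ∀ a → 𝟙 (not (a ==ᵇ false)) ≡ 𝟙 a
differ-false true  = refl
differ-false false = refl

differ-false≤ : ∀ a b c → 𝟙 (not (a ==ᵇ false)) ≤ 𝟙 (not (a ==ᵇ (b ∧ c))) + 𝟙 b
differ-false≤ a b c = ≤-trans (differ-triangle a (b ∧ c) false) (+-monoʳ-≤ (𝟙 (not (a ==ᵇ (b ∧ c)))) (le b c))
  where
  le : ∀ b c → 𝟙 (not ((b ∧ c) ==ᵇ false)) ≤ 𝟙 b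
  le true  true  = ≤ᵇ⇒≤ tt
  le true  false = ≤ᵇ⇒≤ tt
  le false c     = ≤ᵇ⇒≤ tt

disagreement≤ : ∀ {A D η} → A + D ≡ 1ℚ → 1ℚ - η ≤ A → D ≤ η
disagreement≤ {A} {D} {η} A+D≡1 1-η≤A = ≤-by (0≤- 1-η≤A) (trans
  (solve 3 (λ a d e → e := d :+ (a :- (a :+ d :- e))) refl A D η)
  (cong (λ s → D + (A - (s - η))) A+D≡1))

module _ {p ρ : ℚ} (0≤p : 0ℚ ≤ p) (p≤1 : 0ℚ ≤ 1ℚ - p) (0≤ρ : 0ℚ ≤ ρ) (ρ≤1 : 0ℚ ≤ 1ℚ - ρ)
  {n : ℕ} (f g h : BoolFun n) {η : ℚ} (D≤η : E p (λ x → E ρ (disagree f g h x)) ≤ η) where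

  f-bound : ∀ {b c} (P : Cube n → Bool) (u v : Cube n → ℚ) → (∀ x y → 𝟙 (P (x ⋀ y)) ≤ disagree f g h x y + (u x + v y)) →
    E p u ≤ b → E ρ v ≤ c → Pr (ρ * p) P ≤ η + (b + c)
  f-bound P u v le u≤ v≤ = ≤-trans (≤-reflexive (Pr≡E (ρ * p) P))
    (≤-trans (E-⋀≤ 0≤p p≤1 0≤ρ ρ≤1 f g h (λ z → 𝟙 (P z)) u v le) (+-mono-≤ D≤η (+-mono-≤ u≤ v≤)))

  -- `f (x ⋀ y) = 1` forces a disagreement or `g x = 1`.
  f-zero-if-g-rare : ∀ {b} → E p (λ x → 𝟙 (g x)) ≤ b → Pr (ρ * p) (λ z → not (f z ==ᵇ false)) ≤ η + (b + 0ℚ)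
  f-zero-if-g-rare g≤ = f-bound (λ z → not (f z ==ᵇ false)) (λ x → 𝟙 (g x)) (λ _ → 0ℚ)
    (λ x y → ≤-trans (differ-false≤ (f (x ⋀ y)) (g x) (h y))
      (+-monoʳ-≤ (disagree f g h x y) (≤-reflexive (sym (+-identityʳ (𝟙 (g x)))))))
    g≤ (≤-reflexive (E-const n ρ 0ℚ))

  f-zero-if-h-rare : ∀ {b} → E ρ (λ y → 𝟙 (h y)) ≤ b → Pr (ρ * p) (λ z → not (f z ==ᵇ false)) ≤ η + (0ℚ + b)
  f-zero-if-h-rare h≤ = f-bound (λ z → not (f z ==ᵇ false)) (λ _ → 0ℚ) (λ y → 𝟙 (h y))
    (λ x y → ≤-trans (differ-false≤ (f (x ⋀ y)) (h y) (g x))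
      (+-mono-≤ (≤-reflexive (cong (λ b → 𝟙 (not (f (x ⋀ y) ==ᵇ b))) (∧-comm (h y) (g x))))
        (≤-reflexive (sym (+-identityˡ (𝟙 (h y)))))))
    (≤-reflexive (E-const n p 0ℚ)) h≤

  -- The `pow` bounds limit the size of the frequent sets, the `large` bounds leave mass `κ` on the
  -- subcube, and the `room` bounds force the covariance in `frequent⊆`.
  module _ {κ : ℚ} {m : ℕ} (0≤κ : 0ℚ ≤ κ) (η<κ³ : η < κ * (κ * κ))
    (g-pow : pow p m + ι m * κ < E p (λ x → 𝟙 (g x))) (h-pow : pow ρ m + ι m * κ < E ρ (λ y → 𝟙 (h y)))
    (g-large : ι m * κ + κ ≤ E p (λ x → 𝟙 (g x))) (h-large : ι m * κ + κ ≤ E ρ (λ y → 𝟙 (h y)))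
    (g-room : κ + κ ≤ (1ℚ - p) * E p (λ x → 𝟙 (g x))) (h-room : κ + κ ≤ (1ℚ - ρ) * E ρ (λ y → 𝟙 (h y))) where

    W-h≤ : κ * W ρ (frequent p κ g) (λ y → 𝟙 (h y)) ≤ η
    W-h≤ = ≤-trans (κW≤average {κ = κ} 0≤p p≤1 0≤ρ ρ≤1 g (λ y → 𝟙 (h y)))
      (≤-trans (average≤disagreement 0≤p p≤1 0≤ρ ρ≤1 f g h) D≤η)

    W-g≤ : κ * W p (frequent ρ κ h) (λ x → 𝟙 (g x)) ≤ η
    W-g≤ = ≤-trans (κW≤average {κ = κ} 0≤ρ ρ≤1 0≤p p≤1 h (λ x → 𝟙 (g x)))
      (≤-trans (average≤disagreement 0≤ρ ρ≤1 0≤p p≤1 f h g)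
        (≤-trans (≤-reflexive (sym (disagreement-swap p ρ f g h))) D≤η))

    -- Each function is nearly a junta on the other's frequent set, so `frequent⊆` applies in both
    -- directions.
    frequent-agree : frequent p κ g ≡ frequent ρ κ h
    frequent-agree = lookup-antisym (frequent p κ g) (frequent ρ κ h)
      (frequent⊆ 0≤p p≤1 (frequent ρ κ h) g 0≤κ W-g≤ η<κ³ g-room)
      (frequent⊆ 0≤ρ ρ≤1 (frequent p κ g) h 0≤κ W-h≤ η<κ³ h-room)

    g-close : E p (λ x → 𝟙 (not (g x ==ᵇ AND (frequent p κ g) x))) ≤ ι m * κ + κ
    g-close = close-to-AND 0≤p p≤1 m g 0≤κ
      -- `close-to-AND` wants the junta bound on the frequent set of `g` itself, while averaging
      -- gave it on that of `h`.
      (subst (λ T → κ * W p T (λ x → 𝟙 (g x)) ≤ η) (sym frequent-agree) W-g≤) η<κ³ g-pow g-large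

    h-close : E ρ (λ y → 𝟙 (not (h y ==ᵇ AND (frequent p κ g) y))) ≤ ι m * κ + κ
    h-close = subst (λ T → E ρ (λ y → 𝟙 (not (h y ==ᵇ AND T y))) ≤ ι m * κ + κ) (sym frequent-agree)
      (close-to-AND 0≤ρ ρ≤1 m h 0≤κ
        (subst (λ T → κ * W ρ T (λ y → 𝟙 (h y)) ≤ η) frequent-agree W-h≤) η<κ³ h-pow h-large)

    close-to-common-AND : ∃[ T ] (Close (ρ * p) (η + ((ι m * κ + κ) + (ι m * κ + κ))) f (AND T)
      × Close p (ι m * κ + κ) g (AND T) × Close ρ (ι m * κ + κ) h (AND T))
    close-to-common-AND = T ,
      f-bound (λ z → not (f z ==ᵇ AND T z)) (λ x → 𝟙 (not (g x ==ᵇ AND T x))) (λ y → 𝟙 (not (h y ==ᵇ AND T y)))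
        -- Compares `f (x ⋀ y)` with `g x ∧ h y`, and that with `AND T x ∧ AND T y`, which is
        -- `AND T (x ⋀ y)`.
        (λ x y → ≤-trans (differ-triangle (f (x ⋀ y)) (g x ∧ h y) (AND T (x ⋀ y)))
          (+-monoʳ-≤ (disagree f g h x y)
            (subst (λ b → 𝟙 (not ((g x ∧ h y) ==ᵇ b)) ≤ 𝟙 (not (g x ==ᵇ AND T x)) + 𝟙 (not (h y ==ᵇ AND T y)))
              (sym (AND-⋀ T x y)) (differ-∧ (g x) (h y) (AND T x) (AND T y)))))
        g-close h-close ,
      ≤-trans (≤-reflexive (Pr≡E p (λ x → not (g x ==ᵇ AND T x)))) g-close ,
      ≤-trans (≤-reflexive (Pr≡E ρ (λ y → not (h y ==ᵇ AND T y)))) h-close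
      where
      T : Subset n
      T = frequent p κ g

Close-zero : ∀ {n q ε} (g : BoolFun n) → E q (λ x → 𝟙 (g x)) ≤ ε → Close q ε g zeroFun
Close-zero {q = q} g = ≤-trans (≤-reflexive (trans (Pr≡E q (λ x → not (g x ==ᵇ false))) (∑-cong (λ x → differ-false (g x)))))

dichotomy : ∀ {ζ ε κ m} → 0ℚ < ζ → 0ℚ < ε → 0ℚ < κ → κ ≤ 1ℚ →
  κ + κ ≤ ζ * (½ * ε) → (ι m * κ + ι m * κ) + (κ + κ + κ) ≤ ½ * ε →
  (∀ p → 0ℚ ≤ p → p ≤ 1ℚ - ζ → pow p m + pow p m ≤ ½ * ε) →
  ∀ p ρ → ζ ≤ p → p ≤ 1ℚ - ζ → ζ ≤ ρ → ρ ≤ 1ℚ - ζ → ∀ n (f g h : BoolFun n) →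
  1ℚ - ½ * (κ * (κ * κ)) ≤ agreement p ρ f g h →
  (Close (ρ * p) ε f zeroFun × (Close p ε g zeroFun ⊎ Close ρ ε h zeroFun))
  ⊎ (∃[ T ] (Close (ρ * p) ε f (AND T) × Close p ε g (AND T) × Close ρ ε h (AND T)))
dichotomy {ζ} {ε} {κ} {m} 0<ζ 0<ε 0<κ κ≤1 2κ≤ζa 2mκ+3κ≤a pow≤ p ρ ζ≤p p≤ ζ≤ρ ρ≤ n f g h agree =
  cases (≤-total (E p (λ x → 𝟙 (g x))) a) (≤-total (E ρ (λ y → 𝟙 (h y))) a)
  where
  a η u : ℚ
  -- Threshold between rare and non-rare: half of `ε`, leaving the other half for `η` when `f` is
  -- bounded.
  a = ½ * ε
  -- The half makes `η < κ³` strict, as the contradictions from `κ * W ≤ η` require.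
  η = ½ * (κ * (κ * κ))
  u = ι m * κ
  0≤κ : 0ℚ ≤ κ
  0≤κ = <⇒≤ 0<κ
  0≤u : 0ℚ ≤ u
  0≤u = 0≤* (0≤ι m) 0≤κ
  η<κ³ : η < κ * (κ * κ)
  η<κ³ = subst₂ _<_ (+-identityʳ η) (solve 1 (λ k → con ½ :* k :+ con ½ :* k := k) refl (κ * (κ * κ))) (+-monoʳ-< η (0<* 0<½ (0<* 0<κ (0<* 0<κ 0<κ))))
  η≤κ : η ≤ κ
  η≤κ = ≤-trans (<⇒≤ η<κ³) (≤-trans (*-monoʳ-≤ 0≤κ (*-mono-≤ 0≤κ 0≤κ κ≤1 κ≤1)) (≤-reflexive (*-identityʳ κ)))
  a+a≡ε : a + a ≡ ε
  a+a≡ε = solve 1 (λ e → con ½ :* e :+ con ½ :* e := e) refl ε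
  0≤a : 0ℚ ≤ a
  0≤a = <⇒≤ (0<* 0<½ 0<ε)
  a≤ε : a ≤ ε
  a≤ε = ≤-by 0≤a (sym a+a≡ε)
  u+κ≤a : u + κ ≤ a
  u+κ≤a = ≤-trans (≤-by (0≤+ 0≤u (0≤+ 0≤κ 0≤κ))
    (solve 2 (λ u k → (u :+ u) :+ (k :+ k :+ k) := (u :+ k) :+ (u :+ (k :+ k))) refl u κ)) 2mκ+3κ≤a
  κ≤a : κ ≤ a
  κ≤a = ≤-trans (≤-by 0≤u (solve 2 (λ u k → u :+ k := k :+ u) refl u κ)) u+κ≤a
  pow+u<a : ∀ q → 0ℚ ≤ q → q ≤ 1ℚ - ζ → pow q m + u < a
  -- Adding `2 pow ≤ a` and `2u + 3κ ≤ a` gives `2 (pow + u) + 3κ ≤ 2a`, and `3κ` is positive.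
  pow+u<a q 0≤q q≤ = ≰⇒> (λ a≤ → <-irrefl refl (<-≤-trans (0<+ (0<+ 0<κ 0<κ) 0<κ)
    (≤-by (0≤+ (0≤+ (0≤- a≤) (0≤- a≤)) (0≤+ (0≤- (pow≤ q 0≤q q≤)) (0≤- 2mκ+3κ≤a)))
      (solve 4 (λ a P u t → con 0ℚ := t :+ (((P :+ u :- a) :+ (P :+ u :- a)) :+ ((a :- (P :+ P)) :+ (a :- ((u :+ u) :+ t)))))
        refl a (pow q m) u (κ + κ + κ)))))
  0≤ζ : 0ℚ ≤ ζ
  0≤ζ = <⇒≤ 0<ζ
  ζ≤1- : ∀ {q} → q ≤ 1ℚ - ζ → ζ ≤ 1ℚ - q
  ζ≤1- {q} q≤ = ≤-by (0≤- q≤) (solve 2 (λ z q → con 1ℚ :- q := z :+ (con 1ℚ :- z :- q)) refl ζ q)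
  0≤p : 0ℚ ≤ p
  0≤p = ≤-trans 0≤ζ ζ≤p
  0≤ρ : 0ℚ ≤ ρ
  0≤ρ = ≤-trans 0≤ζ ζ≤ρ
  p≤1 : 0ℚ ≤ 1ℚ - p
  p≤1 = ≤-trans 0≤ζ (ζ≤1- p≤)
  ρ≤1 : 0ℚ ≤ 1ℚ - ρ
  ρ≤1 = ≤-trans 0≤ζ (ζ≤1- ρ≤)
  D≤η : E p (λ x → E ρ (disagree f g h x)) ≤ η
  D≤η = disagreement≤ (agreement+disagreement p ρ f g h) agree
  η+a≤ε : η + a ≤ ε
  η+a≤ε = ≤-trans (+-monoˡ-≤ a (≤-trans η≤κ κ≤a)) (≤-reflexive a+a≡ε)
  room : ∀ {q e} → q ≤ 1ℚ - ζ → a ≤ e → κ + κ ≤ (1ℚ - q) * e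
  room q≤ a≤e = ≤-trans 2κ≤ζa (*-mono-≤ 0≤ζ 0≤a (ζ≤1- q≤) a≤e)
  f-total : η + ((u + κ) + (u + κ)) ≤ ε
  -- `g` and `h` each cost `u + κ`; bounding `η` by `κ` supplies the third `κ` of the budget.
  f-total = ≤-trans (+-monoˡ-≤ ((u + κ) + (u + κ)) η≤κ) (≤-trans
    (≤-reflexive (solve 2 (λ u k → k :+ ((u :+ k) :+ (u :+ k)) := (u :+ u) :+ (k :+ k :+ k)) refl u κ))
    (≤-trans 2mκ+3κ≤a a≤ε))
  cases : E p (λ x → 𝟙 (g x)) ≤ a ⊎ a ≤ E p (λ x → 𝟙 (g x)) → E ρ (λ y → 𝟙 (h y)) ≤ a ⊎ a ≤ E ρ (λ y → 𝟙 (h y)) →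
    (Close (ρ * p) ε f zeroFun × (Close p ε g zeroFun ⊎ Close ρ ε h zeroFun))
    ⊎ (∃[ T ] (Close (ρ * p) ε f (AND T) × Close p ε g (AND T) × Close ρ ε h (AND T)))
  cases (inj₁ g≤a) _ = inj₁
    ( ≤-trans (f-zero-if-g-rare 0≤p p≤1 0≤ρ ρ≤1 f g h D≤η g≤a) (subst (λ b → η + b ≤ ε) (sym (+-identityʳ a)) η+a≤ε)
    , inj₁ (Close-zero {q = p} g (≤-trans g≤a a≤ε)))
  cases (inj₂ _) (inj₁ h≤a) = inj₁
    ( ≤-trans (f-zero-if-h-rare 0≤p p≤1 0≤ρ ρ≤1 f g h D≤η h≤a) (subst (λ b → η + b ≤ ε) (sym (+-identityˡ a)) η+a≤ε)
    , inj₂ (Close-zero {q = ρ} h (≤-trans h≤a a≤ε)))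
  cases (inj₂ a≤g) (inj₂ a≤h) =
    let T , f-close , g-close , h-close = close-to-common-AND 0≤p p≤1 0≤ρ ρ≤1 f g h D≤η {κ} {m} 0≤κ η<κ³
          (<-≤-trans (pow+u<a p 0≤p p≤) a≤g) (<-≤-trans (pow+u<a ρ 0≤ρ ρ≤) a≤h)
          (≤-trans u+κ≤a a≤g) (≤-trans u+κ≤a a≤h) (room p≤ a≤g) (room ρ≤ a≤h)
    in inj₂ (T , ≤-trans f-close f-total , ≤-trans g-close (≤-trans u+κ≤a a≤ε) , ≤-trans h-close (≤-trans u+κ≤a a≤ε))

theorem2p10 : (ζ ε : ℚ) → 0ℚ < ζ → 0ℚ < ε →
    ∃[ η ] (0ℚ < η ×
    ((p ρ : ℚ) → ζ ≤ p → p ≤ 1ℚ - ζ → ζ ≤ ρ → ρ ≤ 1ℚ - ζ →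
    (n : ℕ) (f g h : BoolFun n) →
    1ℚ - η ≤ agreement p ρ f g h →
    (Close (ρ * p) ε f zeroFun × (Close p ε g zeroFun ⊎ Close ρ ε h zeroFun))
    ⊎ (∃[ T ] (Close (ρ * p) ε f (AND T) × Close p ε g (AND T) × Close ρ ε h (AND T)))))
theorem2p10 ζ ε 0<ζ 0<ε =
  let m , κ , 0<κ , κ≤1 , 2κ≤ , 2mκ+3κ≤ , pow≤ = constants {ζ} {½ * ε} 0<ζ (0<* 0<½ 0<ε)
  in ½ * (κ * (κ * κ)) , 0<* 0<½ (0<* 0<κ (0<* 0<κ 0<κ)) ,
     dichotomy {ζ} {ε} {κ} {m} 0<ζ 0<ε 0<κ κ≤1 2κ≤ 2mκ+3κ≤ pow≤
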